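{- There exists a constant $c>0$ such that the following holds. Every induced $D_2$-free $3$-uniform hypergraph on $n$ vertices contains a clique or an independent set of size at least $n^{c}$.
   Context: Hypergraphs are finite. $D_2$ denotes the $3$-uniform hypergraph with $4$ vertices and $2$ edges. A $3$-uniform hypergraph is induced $D_2$-free if no set of $4$ of its vertices spans exactly $2$ edges. A clique in a $3$-uniform hypergraph is a vertex set all of whose $3$-subsets are edges; an independent set is a vertex set none of whose $3$-subsets is an edge. -}

module Defs where

open import Data.Nat using (ℕ; _^_; _≤_)
open import Data.Integer using () renaming (∣_∣ to abs)
open import Data.Rational using (ℚ; ↥_; ↧ₙ_)
open import Data.Fin.Subset using (Subset; ∣_∣; _⊆_)
open import Data.Fin.Subset.Properties using (_⊆?_)
open import Data.List using (List; length; filter)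
open import Data.List.Membership.Propositional using (_∈_; _∉_)
open import Data.List.Relation.Unary.All using (All)
open import Data.List.Relation.Unary.Unique.Propositional using (Unique)
open import Relation.Binary.PropositionalEquality using (_≡_; _≢_)

-- The vertex set is Fin n.  The edge set is a duplicate-free list, so that
-- lengths of sublists count edges.
record Hypergraph₃ (n : ℕ) : Set where
  field
    edges   : List (Subset n)
    unique  : Unique edges
    uniform : All (λ e → ∣ e ∣ ≡ 3) edges

open Hypergraph₃ public

module _ {n : ℕ} (H : Hypergraph₃ n) where

  spannedEdges : Subset n → List (Subset n)
  spannedEdges S = filter (_⊆? S) (edges H)

  InducedD₂Free : Set
  InducedD₂Free = ∀ (S : Subset n) → ∣ S ∣ ≡ 4 → length (spannedEdges S) ≢ 2

  IsClique : Subset n → Set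
  IsClique X = ∀ (e : Subset n) → e ⊆ X → ∣ e ∣ ≡ 3 → e ∈ edges H

  IsIndependent : Subset n → Set
  IsIndependent X = ∀ (e : Subset n) → e ⊆ X → ∣ e ∣ ≡ 3 → e ∉ edges H

-- s ≥ n ^ c for a rational exponent c = p / q > 0, in the form n ^ p ≤ s ^ q.
-- Only meaningful for positive c, since the sign of p is discarded.  Rational
-- exponents suffice for an existential claim over real c > 0: if the bound
-- s ≥ n ^ c holds for c, it holds for every positive c′ ≤ c.
AtLeastPower : (s n : ℕ) (c : ℚ) → Set
AtLeastPower s n c = n ^ abs (↥ c) ≤ s ^ ↧ₙ c

{-# OPTIONS --safe #-}
-- Colour each triple by whether it is an edge.  The link of a vertex x contains no induced path on
-- four vertices, so the neighbourhoods of the link-neighbours of y among the other vertices form a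
-- chain.  Taking a largest (or smallest) member of that chain produces pairs (A , B) in which every
-- triple with two vertices in A and one in B has the same colour β; then each pair of B lies in at
-- most one triple of the opposite colour with third vertex in A.  Along such a pair, β-monochromatic
-- sets of B and of A (minus few vertices) can be united, so the product of the sizes of the best
-- clique and the best independent set is superadditive.
--
-- If some two vertices x, y of U have both many common edges and many common non-edges, both parts
-- of such a pair have size linear in |U|.  Otherwise half of U has only small codegrees in one
-- colour; there, splitting off the neighbourhood of a pair of locally maximal codegree d costs
-- only 2d + 2 vertices, so repeating this also loses only a constant factor.  Either way the product
-- doubles whenever |U| grows by a constant factor, hence is polynomial in |U|.

module Submission where

open import Data.Nat using (ℕ)
open import Data.Fin.Subset using (Subset; ∣_∣)
open import Data.Product using (_×_; _,_; ∃-syntax)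
open import Data.Sum using (_⊎_)
open import Defs

module _ where

  open import Data.Nat using (zero; suc; _+_; _*_; _^_; _≤_; _<_; z≤n; s≤s; s≤s⁻¹; _≤?_; _<?_;
    NonZero; >-nonZero; >-nonZero⁻¹)
  open import Data.Nat.Properties
  open import Data.Nat.Coprimality using (1-coprimeTo)
  open import Data.Nat.Tactic.RingSolver using (solve-∀)
  open import Algebra.Properties.CommutativeSemigroup +-commutativeSemigroup using (x∙yz≈y∙xz)
  import Data.Integer as ℤ
  import Data.Rational as ℚ
  open import Data.Bool using (Bool; true; false; not)
  open import Data.Bool.Properties using (not-¬) renaming (_≟_ to _≟ᵇ_)
  open import Data.Fin using (Fin; zero; suc) renaming (_≟_ to _≟ᶠ_)
  open import Data.Vec using ([]; _∷_; here; there)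
  open import Data.Vec.Properties using (≡-dec)
  open import Data.Fin.Subset using (inside; outside; ⁅_⁆; _∪_)
    renaming (⊥ to ∅; ⊤ to full; _∈_ to _∈ˢ_; _∉_ to _∉ˢ_; _⊆_ to _⊆ˢ_)
  open import Data.Fin.Subset.Properties
    using (∉⊥; ∣⊥∣≡0; ∪-identityˡ; ∪-assoc; ∪-comm; x∈⁅x⁆; x∈⁅y⁆⇒x≡y; x∈p∪q⁺; x∈p∪q⁻;
      p⊂q⇒∣p∣<∣q∣; p⊆q⇒∣p∣≤∣q∣)
    renaming (⊆-antisym to ⊆ˢ-antisym; _∈?_ to _∈ˢ?_; _⊆?_ to _⊆ˢ?_)
  open import Data.List using (List; []; _∷_; _++_; length; filter; concatMap; foldr; take; allFin)
  open import Data.List.Properties using (length-++; length-++-sucʳ; length-take; length-tabulate)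
  open import Data.List.Membership.Propositional using (_∈_; _∉_; lose; find)
  open import Data.List.Membership.Propositional.Properties
    using (∈-∃++; ∈-++⁺ˡ; ∈-++⁺ʳ; ∈-++⁻; ∈-filter⁺; ∈-filter⁻; ∈-concatMap⁺; ∈-allFin)
  open import Data.List.Relation.Unary.All as All using ([]; _∷_)
  open import Data.List.Relation.Unary.Any using (Any; any?; here; there)
  open import Data.List.Relation.Unary.AllPairs using ([]; _∷_)
  open import Data.List.Relation.Unary.Unique.Propositional using (Unique)
  import Data.List.Relation.Unary.Unique.Propositional.Properties as Unique
  open import Data.List.Relation.Binary.Subset.Propositional using (_⊆_)
  open import Data.List.Relation.Binary.Subset.Propositional.Properties using (filter-⊆)
  open import Data.Product using (Σ-syntax; proj₁; proj₂)
  open import Data.Sum using (inj₁; inj₂; [_,_]′; map₂)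
  open import Data.Empty using (⊥; ⊥-elim)
  open import Function using (_∘_; flip; id)
  open import Relation.Nullary using (¬_; Dec; yes; no; ¬?; does)
  open import Relation.Nullary.Decidable using (_×-dec_)
  open import Relation.Unary using (Decidable)
  open import Relation.Binary using (DecidableEquality)
  open import Relation.Binary.PropositionalEquality using (_≡_; _≢_; refl; sym; trans; cong; cong₂; subst; ≢-sym)

  -- Counting in duplicate-free lists.

  private variable
    D E : Set

  ⊆⇒length≤ : {xs ys : List D} → Unique xs → xs ⊆ ys → length xs ≤ length ys
  ⊆⇒length≤ {xs = []} _ _ = z≤n
  ⊆⇒length≤ {xs = x ∷ xs} (x∉xs ∷ u) xs⊆ys with ∈-∃++ (xs⊆ys (here refl))
  ... | as , bs , refl = begin
    suc (length xs)         ≤⟨ s≤s (⊆⇒length≤ u xs⊆as++bs) ⟩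
    suc (length (as ++ bs)) ≡⟨ sym (length-++-sucʳ as x bs) ⟩
    length (as ++ x ∷ bs)   ∎
    where
    open ≤-Reasoning
    xs⊆as++bs : xs ⊆ as ++ bs
    xs⊆as++bs y∈xs with ∈-++⁻ as (xs⊆ys (there y∈xs))
    ... | inj₁ y∈as         = ∈-++⁺ˡ y∈as
    ... | inj₂ (here refl)  = ⊥-elim (All.lookup x∉xs y∈xs refl)
    ... | inj₂ (there y∈bs) = ∈-++⁺ʳ as y∈bs

  subsingleton⇒length≤1 : {xs : List D} → Unique xs → (∀ {x y} → x ∈ xs → y ∈ xs → x ≡ y) →
                          length xs ≤ 1
  subsingleton⇒length≤1 {xs = []}         _                 _  = z≤n
  subsingleton⇒length≤1 {xs = x ∷ []}     _                 _  = s≤s z≤n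
  subsingleton⇒length≤1 {xs = x ∷ y ∷ xs} ((x≢y ∷ _) ∷ _) eq = ⊥-elim (x≢y (eq (here refl) (there (here refl))))

  length-concatMap-≤ : (g : D → List E) (xs : List D) {c : ℕ} → (∀ {x} → x ∈ xs → length (g x) ≤ c) →
                       length (concatMap g xs) ≤ length xs * c
  length-concatMap-≤ g []       _ = z≤n
  length-concatMap-≤ g (x ∷ xs) {c} h = begin
    length (g x ++ concatMap g xs)          ≡⟨ length-++ (g x) ⟩
    length (g x) + length (concatMap g xs)  ≤⟨ +-mono-≤ (h (here refl)) (length-concatMap-≤ g xs (h ∘ there)) ⟩
    c + length xs * c                       ∎
    where open ≤-Reasoning

  module _ (g : D → D → List D) (xs : List D) where

    -- Collects the vertices forbidden by ordered pairs from `xs`, where `g x y` lists those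
    -- forbidden by a single pair.
    concatMap₂ : List D
    concatMap₂ = concatMap (λ x → concatMap (g x) xs) xs

    length-concatMap₂-≤ : ∀ {c} → (∀ {x y} → x ∈ xs → y ∈ xs → length (g x y) ≤ c) →
                          length concatMap₂ ≤ length xs * (length xs * c)
    length-concatMap₂-≤ h = length-concatMap-≤ _ xs λ x∈ → length-concatMap-≤ _ xs λ y∈ → h x∈ y∈

    ∈-concatMap₂ : ∀ {x y z} → x ∈ xs → y ∈ xs → z ∈ g x y → z ∈ concatMap₂
    ∈-concatMap₂ x∈ y∈ z∈ = ∈-concatMap⁺ _ (lose x∈ (∈-concatMap⁺ _ (lose y∈ z∈)))

  -- Stated for any total transitive relation, since it serves both for inclusion of link
  -- neighbourhoods, in either direction, and for comparing codegrees.
  greatest : {R : D → D → Set} → (∀ {a b c} → R a b → R b c → R a c) → ∀ {x xs} → x ∈ xs →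
             (∀ {a b} → a ∈ xs → b ∈ xs → R a b ⊎ R b a) →
             ∃[ m ] (m ∈ xs × (∀ {a} → a ∈ xs → R a m))
  greatest {R = R} tr {xs = x ∷ []} _ total =
    x , here refl , λ where (here refl) → [ id , id ]′ (total (here refl) (here refl))
  greatest {R = R} tr {xs = x ∷ y ∷ ys} _ total
    with greatest {R = R} tr {xs = y ∷ ys} (here refl) (λ p q → total (there p) (there q))
  ... | m , m∈ , max with total (here refl) (there m∈)
  ...   | inj₁ xRm = m , there m∈ , λ where
            (here refl) → xRm
            (there a∈)  → max a∈
  ...   | inj₂ mRx = x , here refl , λ where
            (here refl) → [ id , id ]′ (total (here refl) (here refl))
            (there a∈)  → tr (max a∈) mRx

  nonempty⇒∈ : {xs : List D} → 1 ≤ length xs → ∃[ x ] x ∈ xs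
  nonempty⇒∈ {xs = x ∷ _} _ = x , here refl

  module _ {P Q : D → Set} (P? : Decidable P) (Q? : Decidable Q) where

    filter-cover : ∀ xs → (∀ {x} → x ∈ xs → P x ⊎ Q x) →
                   length xs ≤ length (filter P? xs) + length (filter Q? xs)
    filter-cover [] _ = z≤n
    filter-cover (x ∷ xs) h with P? x | Q? x | filter-cover xs (h ∘ there)
    ... | yes _ | yes _ | ih = s≤s (≤-trans ih (+-monoʳ-≤ (length (filter P? xs)) (n≤1+n _)))
    ... | yes _ | no  _ | ih = s≤s ih
    ... | no  _ | yes _ | ih = ≤-trans (s≤s ih) (≤-reflexive (sym (+-suc _ _)))
    ... | no ¬p | no ¬q | ih = ⊥-elim ([ ¬p , ¬q ]′ (h (here refl)))

  +-split-≤ : ∀ m n {h} → h + h ≤ m + n → h ≤ m ⊎ h ≤ n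
  +-split-≤ m n {h} le with h ≤? m | h ≤? n
  ... | yes p | _     = inj₁ p
  ... | no _  | yes q = inj₂ q
  ... | no p  | no q  = ⊥-elim (<-irrefl refl (<-≤-trans (+-mono-< (≰⇒> p) (≰⇒> q)) le))

  -- Every pair (a , b) is counted once, in a row or in a column.
  module _ (R : D → E → Bool) where

    private
      row : List E → D → List E
      row H a = filter (λ b → R a b ≟ᵇ true) H
      column : List D → E → List D
      column L b = filter (λ a → R a b ≟ᵇ false) L

      ∑columns : List D → List E → ℕ
      ∑columns L []      = 0
      ∑columns L (b ∷ H) = length (column L b) + ∑columns L H

      ∑columns-∷ : ∀ a L H → length H + ∑columns L H ≤ length (row H a) + ∑columns (a ∷ L) H
      ∑columns-∷ a L [] = z≤n
      ∑columns-∷ a L (b ∷ H) with R a b | ∑columns-∷ a L H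
      ... | true  | ih = s≤s (begin
        length H + (l + t)        ≡⟨ x∙yz≈y∙xz (length H) l t ⟩
        l + (length H + t)        ≤⟨ +-monoʳ-≤ l ih ⟩
        l + (r + t′)              ≡⟨ x∙yz≈y∙xz l r t′ ⟩
        r + (l + t′)              ∎)
        where
        open ≤-Reasoning
        l = length (column L b)
        r = length (row H a)
        t = ∑columns L H
        t′ = ∑columns (a ∷ L) H
      ... | false | ih = begin
        suc (length H + (l + t))  ≡⟨ cong suc (x∙yz≈y∙xz (length H) l t) ⟩
        suc (l + (length H + t))  ≤⟨ s≤s (+-monoʳ-≤ l ih) ⟩
        suc (l + (r + t′))        ≡⟨ cong suc (x∙yz≈y∙xz l r t′) ⟩
        suc (r + (l + t′))        ≡⟨ sym (+-suc r (l + t′)) ⟩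
        r + suc (l + t′)          ∎
        where
        open ≤-Reasoning
        l = length (column L b)
        r = length (row H a)
        t = ∑columns L H
        t′ = ∑columns (a ∷ L) H

      ∑columns-≤ : ∀ L H {c} → (∀ {b} → b ∈ H → length (column L b) ≤ c) → ∑columns L H ≤ length H * c
      ∑columns-≤ L []      _ = z≤n
      ∑columns-≤ L (b ∷ H) h = +-mono-≤ (h (here refl)) (∑columns-≤ L H (h ∘ there))

      rows+columns : ∀ L H {c} → (∀ {a} → a ∈ L → length (row H a) ≤ c) →
                     length L * length H ≤ length L * c + ∑columns L H
      rows+columns []      H     _ = z≤n
      rows+columns (a ∷ L) H {c} h = begin
        length H + length L * length H                  ≤⟨ +-monoʳ-≤ (length H) (rows+columns L H (h ∘ there)) ⟩
        length H + (length L * c + ∑columns L H)        ≡⟨ x∙yz≈y∙xz (length H) (length L * c) _ ⟩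
        length L * c + (length H + ∑columns L H)        ≤⟨ +-monoʳ-≤ (length L * c) (∑columns-∷ a L H) ⟩
        length L * c + (length (row H a) + ∑columns (a ∷ L) H)
                                                        ≤⟨ +-monoʳ-≤ (length L * c) (+-monoˡ-≤ _ (h (here refl))) ⟩
        length L * c + (c + ∑columns (a ∷ L) H)         ≡⟨ x∙yz≈y∙xz (length L * c) c _ ⟩
        c + (length L * c + ∑columns (a ∷ L) H)         ≡⟨ sym (+-assoc c _ _) ⟩
        (c + length L * c) + ∑columns (a ∷ L) H         ∎
        where
        open ≤-Reasoning

    rows-columns-count : ∀ L H {c} → (∀ {a} → a ∈ L → length (row H a) ≤ c) →
                         (∀ {b} → b ∈ H → length (column L b) ≤ c) →
                         length L * length H ≤ length L * c + length H * c
    rows-columns-count L H rows columns =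
      ≤-trans (rows+columns L H rows) (+-monoʳ-≤ (length L * _) (∑columns-≤ L H columns))
  module _ {V : Set} (_≟_ : DecidableEquality V) where
    open import Data.List.Membership.DecPropositional _≟_ using (_∈?_)

    length-∉-filter : ∀ {xs} (ys : List V) → Unique xs →
                      length xs ≤ length (filter (λ x → ¬? (x ∈? ys)) xs) + length ys
    length-∉-filter {xs} ys u = begin
      length xs                    ≤⟨ ⊆⇒length≤ u cover ⟩
      length (rest ++ ys)          ≡⟨ length-++ rest ⟩
      length rest + length ys      ∎
      where
      open ≤-Reasoning
      rest = filter (λ x → ¬? (x ∈? ys)) xs
      cover : xs ⊆ rest ++ ys
      cover {x} x∈ with x ∈? ys
      ... | yes x∈ys = ∈-++⁺ʳ rest x∈ys
      ... | no x∉ys  = ∈-++⁺ˡ (∈-filter⁺ (λ x → ¬? (x ∈? ys)) x∈ x∉ys)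

    pick-outside : ∀ {xs} (ys : List V) → Unique xs → length ys < length xs →
                   ∃[ v ] (v ∈ xs × v ∉ ys)
    pick-outside {xs} ys u lt with any? (λ x → ¬? (x ∈? ys)) xs
    ... | yes some = find some
    ... | no none  = ⊥-elim (<⇒≱ lt (⊆⇒length≤ u λ {x} x∈ → in-ys x x∈))
      where
      in-ys : ∀ x → x ∈ xs → x ∈ ys
      in-ys x x∈ with x ∈? ys
      ... | yes x∈ys = x∈ys
      ... | no x∉ys  = ⊥-elim (none (lose x∈ x∉ys))

  take-⊆ : {A : Set} (n : ℕ) (xs : List A) → take n xs ⊆ xs
  take-⊆ (suc n) (x ∷ xs) (here e)   = here e
  take-⊆ (suc n) (x ∷ xs) (there x∈) = there (take-⊆ n xs x∈)

  length-take-≤ : {A : Set} (n : ℕ) (xs : List A) → n ≤ length xs → length (take n xs) ≡ n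
  length-take-≤ n xs n≤ = trans (length-take n xs) (m≤n⇒m⊓n≡m n≤)

  ≢-dichotomy : {β γ : Bool} → β ≢ γ → ∀ v → v ≡ β ⊎ v ≡ γ
  ≢-dichotomy {true}  {true}  β≢γ _     = ⊥-elim (β≢γ refl)
  ≢-dichotomy {true}  {false} _   true  = inj₁ refl
  ≢-dichotomy {true}  {false} _   false = inj₂ refl
  ≢-dichotomy {false} {true}  _   true  = inj₂ refl
  ≢-dichotomy {false} {true}  _   false = inj₁ refl
  ≢-dichotomy {false} {false} β≢γ _     = ⊥-elim (β≢γ refl)

  -- Two-coloured triples and the structure of links.

  -- Two triples of a four-set share two vertices, so up to naming `D₂-free` covers every four-set
  -- with exactly two triples of colour `γ`. Such a four-set has exactly two triples of colour `β`
  -- as well, so the condition is symmetric in the colours.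
  record Colouring (V : Set) : Set where
    field
      colour  : V → V → V → Bool
      swap₁₂  : ∀ a b c → colour a b c ≡ colour b a c
      swap₂₃  : ∀ a b c → colour a b c ≡ colour a c b
      D₂-free : ∀ {β γ a b c d} → β ≢ γ → a ≢ b → a ≢ c → a ≢ d → b ≢ c → b ≢ d → c ≢ d →
                colour a b c ≡ γ → colour a b d ≡ γ → colour a c d ≡ β → colour b c d ≡ β → ⊥

  module _ {V : Set} (_≟_ : DecidableEquality V) (C : Colouring V) where
    open Colouring C renaming (colour to f)
    open import Data.List.Membership.DecPropositional _≟_ using (_∈?_)

    private variable
      a b c d v w x y z a′ b′ : V
      β γ δ : Bool
      U W A B X : List V
      m n : ℕ

    s₁₂ : f a b c ≡ δ → f b a c ≡ δ
    s₁₂ e = trans (swap₁₂ _ _ _) e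

    s₂₃ : f a b c ≡ δ → f a c b ≡ δ
    s₂₃ e = trans (swap₂₃ _ _ _) e

    rot : f a b c ≡ δ → f b c a ≡ δ
    rot e = s₂₃ (s₁₂ e)

    rot² : f a b c ≡ δ → f c a b ≡ δ
    rot² e = s₁₂ (s₂₃ e)

    module Opposite {β γ : Bool} (β≢γ : β ≢ γ) where

      clash : {t : Bool} → t ≡ β → t ≡ γ → ⊥
      clash p q = β≢γ (trans (sym p) q)

      split : ∀ t → t ≡ β ⊎ t ≡ γ
      split = ≢-dichotomy β≢γ

      force-β : {t : Bool} → (t ≡ γ → ⊥) → t ≡ β
      force-β {t} h = [ id , ⊥-elim ∘ h ]′ (split t)

      force-γ : {t : Bool} → (t ≡ β → ⊥) → t ≡ γ
      force-γ {t} h = [ ⊥-elim ∘ h , id ]′ (split t)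

      -- Suppose `f a a′ b ≡ γ`. The four-sets on `x`, `y`, `b` with `a` or `a′` make `f y a b` and
      -- `f y a′ b` equal to `β`. If `f x a a′ ≡ γ`, the four-set `x a a′ b` has exactly two triples
      -- of each colour; otherwise `f y a a′ ≡ γ` is forced and `y a a′ b` is the bad four-set.
      star : x ≢ y → x ≢ a → x ≢ a′ → x ≢ b → y ≢ a → y ≢ a′ → y ≢ b → a ≢ a′ → a ≢ b → a′ ≢ b →
             f x y a ≡ γ → f x y a′ ≡ γ → f x y b ≡ β → f x a b ≡ β → f x a′ b ≡ β → f a a′ b ≡ β
      star {x} {y} {a} {a′} {b} x≢y x≢a x≢a′ x≢b y≢a y≢a′ y≢b a≢a′ a≢b a′≢b xya xya′ xyb xab xa′b =
        force-β λ aa′b → [ via-y aa′b , via-x aa′b ]′ (split (f x a a′))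
        where
        yab : f y a b ≡ β
        yab = force-β λ h → D₂-free β≢γ y≢a (≢-sym x≢y) y≢b (≢-sym x≢a) a≢b x≢b
                (rot xya) h (s₁₂ xyb) (s₁₂ xab)
        ya′b : f y a′ b ≡ β
        ya′b = force-β λ h → D₂-free β≢γ y≢a′ (≢-sym x≢y) y≢b (≢-sym x≢a′) a′≢b x≢b
                (rot xya′) h (s₁₂ xyb) (s₁₂ xa′b)
        via-x : f a a′ b ≡ γ → f x a a′ ≡ γ → ⊥
        via-x aa′b xaa′ = D₂-free β≢γ a≢a′ (≢-sym x≢a) a≢b (≢-sym x≢a′) a′≢b x≢b
          (rot xaa′) aa′b (s₁₂ xab) (s₁₂ xa′b)
        via-y : f a a′ b ≡ γ → f x a a′ ≡ β → ⊥
        via-y aa′b xaa′ = D₂-free β≢γ a≢a′ (≢-sym y≢a) a≢b (≢-sym y≢a′) a′≢b y≢b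
          (rot yaa′) aa′b (s₁₂ yab) (s₁₂ ya′b)
          where
          yaa′ : f y a a′ ≡ γ
          yaa′ = force-γ λ h → D₂-free β≢γ x≢y x≢a x≢a′ y≢a y≢a′ a≢a′ xya xya′ xaa′ h

      -- If the link of `x` induced the path `a b c d`, the four-sets containing `x` would force `γ`
      -- on `abc` and `bcd` and `β` on `abd` and `acd`, so `a b c d` itself would be a bad four-set.
      P₄-free : x ≢ a → x ≢ b → x ≢ c → x ≢ d →
                f x a b ≡ γ → f x b c ≡ γ → f x c d ≡ γ →
                f x a c ≡ β → f x b d ≡ β → f x a d ≡ β → ⊥
      P₄-free {x} {a} {b} {c} {d} x≢a x≢b x≢c x≢d ab bc cd ac bd ad =
        D₂-free β≢γ b≢c (≢-sym a≢b) b≢d (≢-sym a≢c) c≢d a≢d (rot abc) bcd (s₁₂ abd) (s₁₂ acd)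
        where
        b≢c : b ≢ c
        b≢c refl = clash ac ab
        c≢d : c ≢ d
        c≢d refl = clash bd bc
        a≢b : a ≢ b
        a≢b refl = clash ac bc
        b≢d : b ≢ d
        b≢d refl = clash ad ab
        a≢c : a ≢ c
        a≢c refl = clash ad cd
        a≢d : a ≢ d
        a≢d refl = clash (s₂₃ ac) cd
        abc : f a b c ≡ γ
        abc = force-γ λ h → D₂-free β≢γ x≢b x≢a x≢c (≢-sym a≢b) b≢c a≢c (s₂₃ ab) bc ac (s₁₂ h)
        bcd : f b c d ≡ γ
        bcd = force-γ λ h → D₂-free β≢γ x≢c x≢b x≢d (≢-sym b≢c) c≢d b≢d (s₂₃ bc) cd bd (s₁₂ h)
        abd : f a b d ≡ β
        abd = force-β λ h → D₂-free β≢γ a≢b (≢-sym x≢a) a≢d (≢-sym x≢b) b≢d x≢d (rot ab) h (s₁₂ ad) (s₁₂ bd)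
        acd : f a c d ≡ β
        acd = force-β λ h → D₂-free β≢γ c≢d (≢-sym x≢c) (≢-sym a≢c) (≢-sym x≢d) (≢-sym a≢d) x≢a
                (rot cd) (rot h) (rot² ac) (rot² ad)

      -- In the link of x, the neighbourhoods of z and c outside the neighbourhood of y are comparable.
      nested : x ≢ y → x ≢ z → x ≢ a → x ≢ b → x ≢ c →
               f x y z ≡ γ → f x y c ≡ γ → f x y a ≡ β → f x y b ≡ β →
               f x z a ≡ γ → f x c a ≡ β → f x c b ≡ γ → f x z b ≡ β → ⊥
      nested {x} {y} {z} {a} {b} {c} x≢y x≢z x≢a x≢b x≢c yz yc ya yb za ca cb zb =
        -- Depending on `f x z c` and `f x a b`, the induced path is `a z y c`, `a z c b` or
        -- `y z a b`.
        [ (λ zc → P₄-free x≢a x≢z x≢y x≢c (s₂₃ za) (s₂₃ yz) yc (s₂₃ ya) zc (s₂₃ ca))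
        , (λ zc → [ (λ ab → P₄-free x≢a x≢z x≢c x≢b (s₂₃ za) zc cb (s₂₃ ca) zb ab)
                  , (λ ab → P₄-free x≢y x≢z x≢a x≢b yz za ab ya zb yb)
                  ]′ (split (f x a b)))
        ]′ (split (f x z c))

    -- Monochromatic sets, pairs and codegrees.

    Mono : Bool → List V → Set
    Mono β X = ∀ {a b c} → a ∈ X → b ∈ X → c ∈ X → a ≢ b → a ≢ c → b ≢ c → f a b c ≡ β

    -- Triples with one vertex in `A` and two in `B` are left open; `pair-nbr-unique` later bounds
    -- the exceptions among them.
    Pair : Bool → List V → List V → Set
    Pair β A B = (∀ {a a′ b} → a ∈ A → a′ ∈ A → b ∈ B → a ≢ a′ → f a a′ b ≡ β) ×
                 (∀ {a b} → a ∈ A → b ∈ B → a ≢ b)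

    mono-[] : Mono β []
    mono-[] ()

    mono-[_] : ∀ v → Mono β (v ∷ [])
    mono-[ v ] (here refl) (here refl) _ v≢v = ⊥-elim (v≢v refl)

    mono-++ : Mono β A → Mono β B →
              (∀ {a a′ b} → a ∈ A → a′ ∈ A → b ∈ B → a ≢ a′ → f a a′ b ≡ β) →
              (∀ {a b b′} → a ∈ A → b ∈ B → b′ ∈ B → b ≢ b′ → f b b′ a ≡ β) →
              Mono β (A ++ B)
    mono-++ {A = A} mA mB AAB ABB a∈ b∈ c∈ a≢b a≢c b≢c with ∈-++⁻ A a∈ | ∈-++⁻ A b∈ | ∈-++⁻ A c∈
    ... | inj₁ a∈ | inj₁ b∈ | inj₁ c∈ = mA a∈ b∈ c∈ a≢b a≢c b≢c
    ... | inj₁ a∈ | inj₁ b∈ | inj₂ c∈ = AAB a∈ b∈ c∈ a≢b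
    ... | inj₁ a∈ | inj₂ b∈ | inj₁ c∈ = s₂₃ (AAB a∈ c∈ b∈ a≢c)
    ... | inj₁ a∈ | inj₂ b∈ | inj₂ c∈ = rot² (ABB a∈ b∈ c∈ b≢c)
    ... | inj₂ a∈ | inj₁ b∈ | inj₁ c∈ = rot² (AAB b∈ c∈ a∈ b≢c)
    ... | inj₂ a∈ | inj₁ b∈ | inj₂ c∈ = s₂₃ (ABB b∈ a∈ c∈ a≢c)
    ... | inj₂ a∈ | inj₂ b∈ | inj₁ c∈ = ABB c∈ a∈ b∈ a≢b
    ... | inj₂ a∈ | inj₂ b∈ | inj₂ c∈ = mB a∈ b∈ c∈ a≢b a≢c b≢c

    -- The vertex `w` is kept apart from `x` and `y` because `D₂-free` says nothing about degenerate
    -- triples.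
    Nbr : V → V → Bool → V → Set
    Nbr x y δ w = w ≢ x × w ≢ y × f x y w ≡ δ

    nbr? : ∀ x y δ → Decidable (Nbr x y δ)
    nbr? x y δ w = ¬? (w ≟ x) ×-dec ¬? (w ≟ y) ×-dec (f x y w ≟ᵇ δ)

    N : V → V → Bool → List V → List V
    N x y δ U = filter (nbr? x y δ) U

    ∈-N⁺ : w ∈ U → w ≢ x → w ≢ y → f x y w ≡ δ → w ∈ N x y δ U
    ∈-N⁺ w∈U w≢x w≢y e = ∈-filter⁺ (nbr? _ _ _) w∈U (w≢x , w≢y , e)

    ∈-N⁻ : w ∈ N x y δ U → w ∈ U × Nbr x y δ w
    ∈-N⁻ = ∈-filter⁻ (nbr? _ _ _)

    -- Pairs from the chain of neighbourhoods in a link.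

    module _ {β γ : Bool} (β≢γ : β ≢ γ) {x y : V} (x≢y : x ≢ y) {A B : List V}
             (A-nbr : ∀ {a} → a ∈ A → Nbr x y γ a) (B-nbr : ∀ {b} → b ∈ B → Nbr x y β b) where
      open Opposite β≢γ

      private
        -- Inclusion of the neighbourhoods within `B` in the `γ`-coloured link of `x`; `nested`
        -- makes it total on `A`.
        _≼_ : V → V → Set
        a ≼ a′ = ∀ {b} → b ∈ B → f x a b ≡ γ → f x a′ b ≡ γ

        ≼-trans : a ≼ b → b ≼ c → a ≼ c
        ≼-trans p q b∈B e = q b∈B (p b∈B e)

        ≼-total : a ∈ A → a′ ∈ A → a ≼ a′ ⊎ a′ ≼ a
        ≼-total {a} {a′} a∈A a′∈A
          with any? (λ b → (f x a b ≟ᵇ γ) ×-dec (f x a′ b ≟ᵇ β)) B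
        ... | no none = inj₁ λ b∈B e → force-γ λ h → none (lose b∈B (e , h))
        ... | yes some with find some | A-nbr a∈A | A-nbr a′∈A
        ...   | b , b∈B , xab , xa′b | a≢x , _ , xya | a′≢x , _ , xya′ = inj₂ λ {b′} b′∈B xa′b′ →
          force-γ λ xab′ → let b≢x , _ , xyb = B-nbr b∈B ; b′≢x , _ , xyb′ = B-nbr b′∈B in
          nested x≢y (≢-sym a≢x) (≢-sym b≢x) (≢-sym b′≢x) (≢-sym a′≢x) xya xya′ xyb xyb′ xab xa′b xa′b′ xab′

        A≢B : a ∈ A → b ∈ B → a ≢ b
        A≢B a∈A b∈B refl = clash (proj₂ (proj₂ (B-nbr b∈B))) (proj₂ (proj₂ (A-nbr a∈A)))

      -- For `m` with the largest neighbourhood, a `b` outside it lies outside the neighbourhood of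
      -- every `a` in `A₀`, and `star` then colours the triples `a a′ b`.
      link-max : ∀ {A₀ a₀} → A₀ ⊆ A → a₀ ∈ A₀ →
                 ∃[ m ] (m ∈ A₀ × Pair β A₀ (filter (λ b → f x m b ≟ᵇ β) B))
      link-max {A₀} sub a₀∈ with greatest {R = _≼_} ≼-trans a₀∈ (λ p q → ≼-total (sub p) (sub q))
      ... | m , m∈ , max = m , m∈ , AAB , λ a∈ b∈ → A≢B (sub a∈) (proj₁ (∈-filter⁻ (λ b → f x m b ≟ᵇ β) b∈))
        where
        AAB : ∀ {a a′ b} → a ∈ A₀ → a′ ∈ A₀ → b ∈ filter (λ b → f x m b ≟ᵇ β) B → a ≢ a′ → f a a′ b ≡ β
        AAB a∈ a′∈ b∈ a≢a′ with A-nbr (sub a∈) | A-nbr (sub a′∈) | ∈-filter⁻ (λ b → f x m b ≟ᵇ β) b∈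
        ... | a≢x , a≢y , xya | a′≢x , a′≢y , xya′ | b∈B , xmb with B-nbr b∈B
        ... | b≢x , b≢y , xyb = star x≢y (≢-sym a≢x) (≢-sym a′≢x) (≢-sym b≢x) (≢-sym a≢y) (≢-sym a′≢y) (≢-sym b≢y)
          a≢a′ (A≢B (sub a∈) b∈B) (A≢B (sub a′∈) b∈B) xya xya′ xyb
          (force-β λ h → clash xmb (max a∈ b∈B h)) (force-β λ h → clash xmb (max a′∈ b∈B h))

      -- The dual of `link-max`: a `b` in the smallest neighbourhood lies in all of them, and `star`
      -- with the colours exchanged applies with the roles of `A` and `B` reversed.
      link-min : ∀ {A₀ a₀} → A₀ ⊆ A → a₀ ∈ A₀ →
                 ∃[ m ] (m ∈ A₀ × Pair γ (filter (λ b → f x m b ≟ᵇ γ) B) A₀)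
      link-min {A₀} sub a₀∈ with greatest {R = flip _≼_} (flip ≼-trans) a₀∈ (λ p q → ≼-total (sub q) (sub p))
      ... | m , m∈ , min = m , m∈ , BBA , λ b∈ a∈ → ≢-sym (A≢B (sub a∈) (proj₁ (∈-filter⁻ (λ b → f x m b ≟ᵇ γ) b∈)))
        where
        BBA : ∀ {b b′ a} → b ∈ filter (λ b → f x m b ≟ᵇ γ) B → b′ ∈ filter (λ b → f x m b ≟ᵇ γ) B →
              a ∈ A₀ → b ≢ b′ → f b b′ a ≡ γ
        BBA b∈ b′∈ a∈ b≢b′ with ∈-filter⁻ (λ b → f x m b ≟ᵇ γ) b∈ | ∈-filter⁻ (λ b → f x m b ≟ᵇ γ) b′∈ | A-nbr (sub a∈)
        ... | b∈B , xmb | b′∈B , xmb′ | a≢x , a≢y , xya with B-nbr b∈B | B-nbr b′∈B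
        ... | b≢x , b≢y , xyb | b′≢x , b′≢y , xyb′ = Opposite.star (≢-sym β≢γ) x≢y
          (≢-sym b≢x) (≢-sym b′≢x) (≢-sym a≢x) (≢-sym b≢y) (≢-sym b′≢y) (≢-sym a≢y)
          b≢b′ (≢-sym (A≢B (sub a∈) b∈B)) (≢-sym (A≢B (sub a∈) b′∈B)) xyb xyb′ xya
          (s₂₃ (min a∈ b∈B xmb)) (s₂₃ (min a∈ b′∈B xmb′))

    codegree-⊆ : ∀ {x y} → U ⊆ W → Unique U → length (N x y γ U) ≤ length (N x y γ W)
    codegree-⊆ {U} {γ = γ} {x = x} {y} U⊆W uU = ⊆⇒length≤ (Unique.filter⁺ (nbr? x y γ) uU) λ w∈ →
      let w∈U , nbr = ∈-N⁻ {U = U} w∈ in ∈-filter⁺ (nbr? x y γ) (U⊆W w∈U) nbr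

    -- The maximum is taken with `x` fixed: `sparse-pair` compares `y` only with other partners of
    -- `x`.
    max-codegree : ∀ {x y₀} → y₀ ∈ W → x ≢ y₀ →
                   ∃[ y ] (y ∈ W × x ≢ y × (∀ {z} → z ∈ W → x ≢ z →
                     length (N x z γ W) ≤ length (N x y γ W)))
    max-codegree {W} {γ} {x} {y₀} y₀∈W x≢y₀ with
      greatest {R = λ y z → codegree y ≤ codegree z} ≤-trans (∈-filter⁺ ≢x? y₀∈W x≢y₀)
        (λ {y} {z} _ _ → ≤-total (codegree y) (codegree z))
      where
      codegree : V → ℕ
      codegree y = length (N x y γ W)
      ≢x? : Decidable (x ≢_)
      ≢x? y = ¬? (x ≟ y)
    ... | y , y∈ , max with ∈-filter⁻ (λ y → ¬? (x ≟ y)) {xs = W} y∈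
    ...   | y∈W , x≢y = y , y∈W , x≢y , λ z∈W x≢z → max (∈-filter⁺ (λ y → ¬? (x ≟ y)) z∈W x≢z)

    -- W is covered by x, y, the common neighbourhood, M, and the neighbours in the link of x of a
    -- single p, which are no more than the neighbours of y by maximality.
    sparse-pair : β ≢ γ → Unique W → ∀ {x y} → x ∈ W → x ≢ y → 1 ≤ length (N x y γ W) →
                  (∀ {z} → z ∈ W → x ≢ z → length (N x z γ W) ≤ length (N x y γ W)) →
                  ∃[ M ] (Pair β (N x y γ W) M × M ⊆ W × Unique M × length M < length W ×
                          length W ≤ 2 + 2 * length (N x y γ W) + length M)
    sparse-pair {β} {γ} {W} β≢γ uW {x} {y} x∈W x≢y 1≤d max
      with link-max β≢γ x≢y {A = N x y γ W} {B = N x y β W}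
             (λ z∈ → proj₂ (∈-N⁻ {U = W} z∈)) (λ z∈ → proj₂ (∈-N⁻ {U = W} z∈))
             id (proj₂ (nonempty⇒∈ 1≤d))
    ... | p , p∈P , pair = M , pair , M⊆W , uM , M<W , W-cover
      where
      P = N x y γ W
      Q = N x y β W
      deg = length P
      on? : ∀ δ → Decidable (λ q → f x p q ≡ δ)
      on? δ q = f x p q ≟ᵇ δ
      S = filter (on? γ) Q
      M = filter (on? β) Q

      P⁻ : z ∈ P → z ∈ W × Nbr x y γ z
      P⁻ = ∈-N⁻ {U = W}
      Q⁻ : z ∈ Q → z ∈ W × Nbr x y β z
      Q⁻ = ∈-N⁻ {U = W}
      M⁻ : z ∈ M → z ∈ W × Nbr x y β z
      M⁻ z∈M = Q⁻ (proj₁ (∈-filter⁻ (on? β) {xs = Q} z∈M))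
      M⊆W : M ⊆ W
      M⊆W = proj₁ ∘ M⁻
      uQ : Unique Q
      uQ = Unique.filter⁺ (nbr? x y β) uW
      uM : Unique M
      uM = Unique.filter⁺ (on? β) uQ

      -- The vertex `x` lies in `W` but not in `M`; strictness is what allows `solve-sparse` to
      -- recurse on `M`.
      M<W : length M < length W
      M<W = ⊆⇒length≤ (All.tabulate (λ z∈M x≡z → proj₁ (proj₂ (M⁻ z∈M)) (sym x≡z)) ∷ uM)
        λ { (here refl) → x∈W ; (there z∈M) → M⊆W z∈M }

      S⊆N : S ⊆ N x p γ W
      S⊆N z∈ with ∈-filter⁻ (on? γ) {xs = Q} z∈
      ... | z∈Q , xpz with Q⁻ z∈Q | P⁻ p∈P
      ...   | z∈W , z≢x , _ , xyz | _ , _ , _ , xyp =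
        ∈-N⁺ z∈W z≢x (λ { refl → β≢γ (trans (sym xyz) xyp) }) xpz

      S≤deg : length S ≤ deg
      S≤deg = ≤-trans (⊆⇒length≤ (Unique.filter⁺ (on? γ) uQ) S⊆N)
        (max (proj₁ (P⁻ p∈P)) (≢-sym (proj₁ (proj₂ (P⁻ p∈P)))))

      cover : W ⊆ x ∷ y ∷ (P ++ Q)
      cover {z} z∈ with z ≟ x | z ≟ y
      ... | yes e | _     = here e
      ... | no _  | yes e = there (here e)
      ... | no z≢x | no z≢y with ≢-dichotomy β≢γ (f x y z)
      ...   | inj₁ e = there (there (∈-++⁺ʳ P (∈-N⁺ z∈ z≢x z≢y e)))
      ...   | inj₂ e = there (there (∈-++⁺ˡ (∈-N⁺ z∈ z≢x z≢y e)))

      W-cover : length W ≤ 2 + 2 * deg + length M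
      W-cover = begin
        length W                          ≤⟨ ⊆⇒length≤ uW cover ⟩
        2 + length (P ++ Q)               ≡⟨ cong (2 +_) (length-++ P) ⟩
        2 + (deg + length Q)                ≤⟨ +-monoʳ-≤ 2 (+-monoʳ-≤ deg (filter-cover (on? γ) (on? β) Q λ {q} _ →
                                               ≢-dichotomy (≢-sym β≢γ) (f x p q))) ⟩
        2 + (deg + (length S + length M))   ≤⟨ +-monoʳ-≤ 2 (+-monoʳ-≤ deg (+-monoˡ-≤ (length M) S≤deg)) ⟩
        2 + (deg + (deg + length M))      ≡⟨ regroup deg (length M) ⟩
        2 + 2 * deg + length M            ∎
        where
        open ≤-Reasoning
        regroup : ∀ d m → 2 + (d + (d + m)) ≡ 2 + 2 * d + m
        regroup = solve-∀

    -- Half of the vertices have small codegrees in one colour.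

    module Heavy {U : List V} (uU : Unique U) {r : ℕ} (1≤r : 1 ≤ r)
                 (polarised : ∀ {x y} → x ∈ U → y ∈ U → x ≢ y →
                              length (N x y true U) < r ⊎ length (N x y false U) < r) where

      private
        codegree : Bool → V → V → ℕ
        codegree γ x y = length (N x y γ U)

        heavy? : ∀ γ x → Decidable (λ y → x ≢ y × r ≤ codegree γ x y)
        heavy? γ x y = ¬? (x ≟ y) ×-dec (r ≤? codegree γ x y)

        heavy : Bool → V → List V
        heavy γ x = filter (heavy? γ x) U

        uHeavy : Unique (heavy γ x)
        uHeavy {γ} {x} = Unique.filter⁺ (heavy? γ x) uU

        heavy⇒light : β ≢ γ → x ∈ U → y ∈ U → x ≢ y → r ≤ codegree γ x y → codegree β x y < r
        heavy⇒light {true}  {true}  β≢γ _ _ _ _ = ⊥-elim (β≢γ refl)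
        heavy⇒light {false} {false} β≢γ _ _ _ _ = ⊥-elim (β≢γ refl)
        heavy⇒light {true}  {false} _ x∈ y∈ x≢y h = [ id , (λ lt → ⊥-elim (<⇒≱ lt h)) ]′ (polarised x∈ y∈ x≢y)
        heavy⇒light {false} {true}  _ x∈ y∈ x≢y h = [ (λ lt → ⊥-elim (<⇒≱ lt h)) , id ]′ (polarised x∈ y∈ x≢y)

        ∉heavy⇒light : y ∈ U → x ≢ y → y ∉ heavy γ x → codegree γ x y < r
        ∉heavy⇒light {y} {x} {γ} y∈ x≢y y∉ = ≰⇒> λ h → y∉ (∈-filter⁺ (heavy? γ x) y∈ (x≢y , h))

        heavy⁻ : y ∈ heavy γ x → y ∈ U × x ≢ y × r ≤ codegree γ x y
        heavy⁻ {γ = γ} {x} = ∈-filter⁻ (heavy? γ x) {xs = U}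

        heavy-disjoint : x ∈ U → β ≢ γ → y ∈ heavy β x → z ∈ heavy γ x → y ≢ z
        heavy-disjoint x∈ β≢γ y∈ z∈ refl with heavy⁻ y∈ | heavy⁻ z∈
        ... | y∈U , x≢y , hy | _ , _ , hz = <⇒≱ (heavy⇒light β≢γ x∈ y∈U x≢y hz) hy

        -- Since `y` and `z` are heavy in different colours they differ, so the filtered list sits
        -- inside `N x z δ U`. The bound variable is one less than the strict codegree bound.
        link-≤ : ∀ {r} δ {ys} → x ∈ U → β ≢ γ → Unique ys → ys ⊆ heavy β x → z ∈ heavy γ x → codegree δ x z < suc r →
                 length (filter (λ y → f x z y ≟ᵇ δ) ys) ≤ r
        link-≤ {x} {z = z} δ {ys} x∈ β≢γ uys ys⊆ z∈ small = ≤-trans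
          (⊆⇒length≤ (Unique.filter⁺ (λ y → f x z y ≟ᵇ δ) uys) λ y∈ →
            let y∈ys , xzy = ∈-filter⁻ (λ y → f x z y ≟ᵇ δ) {xs = ys} y∈
                y∈U , x≢y , _ = heavy⁻ (ys⊆ y∈ys) in
            ∈-N⁺ y∈U (≢-sym x≢y) (heavy-disjoint x∈ β≢γ (ys⊆ y∈ys) z∈) xzy)
          (s≤s⁻¹ small)

        -- Double counting of f x on heavy false x × heavy true x.
        few-heavy : x ∈ U → length (heavy true x) < 2 * r ⊎ length (heavy false x) < 2 * r
        few-heavy {x} x∈ with 2 * r ≤? length (heavy true x) | 2 * r ≤? length (heavy false x)
        ... | no ¬p | _     = inj₁ (≰⇒> ¬p)
        ... | yes _ | no ¬q = inj₂ (≰⇒> ¬q)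
        ... | yes p | yes q = ⊥-elim (absurd r 1≤r p q refl)
          where
          open ≤-Reasoning
          absurd : ∀ r′ → 1 ≤ r′ → 2 * r′ ≤ length (heavy true x) → 2 * r′ ≤ length (heavy false x) → r ≡ r′ → ⊥
          -- With `r = suc c`, rows and columns have at most `c` entries, so `2 l h` is at most
          -- `2 c (l + h)`, whereas `l` and `h` being at least `2 r` makes `2 l h` at least
          -- `2 (c + 1) (l + h)`.
          absurd (suc c) _ p q refl = <⇒≱ (≤-trans (≤-trans (s≤s z≤n) p) (≤-trans (m≤m+n h l) (m≤m+n (h + l) _)))
            (+-cancelˡ-≤ (l * c + h * c + (l * c + h * c)) _ _ (begin
              l * c + h * c + (l * c + h * c) + 2 * (h + l)   ≡⟨ regroup l h c ⟩
              l * (2 * suc c) + h * (2 * suc c)               ≤⟨ +-mono-≤ (*-monoʳ-≤ l p) (*-monoʳ-≤ h q) ⟩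
              l * h + h * l                                   ≡⟨ cong (l * h +_) (*-comm h l) ⟩
              l * h + l * h                                   ≤⟨ +-mono-≤ count count ⟩
              l * c + h * c + (l * c + h * c)                 ≡⟨ sym (+-identityʳ _) ⟩
              l * c + h * c + (l * c + h * c) + 0             ∎))
            where
            l = length (heavy false x)
            h = length (heavy true x)
            regroup : ∀ l h c → l * c + h * c + (l * c + h * c) + 2 * (h + l) ≡ l * (2 * suc c) + h * (2 * suc c)
            regroup = solve-∀
            count : l * h ≤ l * c + h * c
            count = rows-columns-count (f x) (heavy false x) (heavy true x)
              (λ b∈ → let b∈U , x≢b , hb = heavy⁻ b∈ in
                link-≤ true x∈ (λ ()) uHeavy id b∈ (heavy⇒light (λ ()) x∈ b∈U x≢b hb))
              (λ {a} a∈ → let a∈U , x≢a , ha = heavy⁻ a∈ in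
                ≤-trans (⊆⇒length≤ (Unique.filter⁺ (λ b → f x b a ≟ᵇ false) uHeavy) (λ b∈ →
                  let b∈B , e = ∈-filter⁻ (λ b → f x b a ≟ᵇ false) {xs = heavy false x} b∈ in
                  ∈-filter⁺ (λ b → f x a b ≟ᵇ false) b∈B (s₂₃ e)))
                (link-≤ false x∈ (λ ()) uHeavy id a∈ (heavy⇒light (λ ()) x∈ a∈U x≢a ha)))

        -- If z is a common γ-neighbour of x and y, then D₂-freeness forces every other common
        -- γ-neighbour w to satisfy f x z w ≡ γ or f y z w ≡ γ, so z cannot be light with both.
        no-heavy-pair : β ≢ γ → 7 * r < length U → x ∈ U → y ∈ U → x ≢ y →
                        length (heavy γ x) < 2 * r → length (heavy γ y) < 2 * r → codegree γ x y < r
        no-heavy-pair {β} {γ} {x} {y} β≢γ U-large x∈ y∈ x≢y few-x few-y = ≰⇒> λ heavy-xy →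
          contradiction-from (heavy⇒light β≢γ x∈ y∈ x≢y heavy-xy)
          where
          open ≤-Reasoning
          contradiction-from : codegree β x y < r → ⊥
          -- The excluded list has at most `2r + r + 2r + 2r` vertices, which is the source of the
          -- constant 7; the second exclusion below needs only `6 * r`.
          contradiction-from light-xy with pick-outside _≟_ (x ∷ y ∷ N x y β U ++ heavy γ x ++ heavy γ y) uU fits
            where
            fits : length (x ∷ y ∷ N x y β U ++ heavy γ x ++ heavy γ y) < length U
            fits = ≤-<-trans (begin
              2 + length (N x y β U ++ heavy γ x ++ heavy γ y)
                ≡⟨ cong (2 +_) (trans (length-++ (N x y β U)) (cong (codegree β x y +_) (length-++ (heavy γ x)))) ⟩
              2 + (codegree β x y + (length (heavy γ x) + length (heavy γ y)))
                ≤⟨ +-mono-≤ (*-monoʳ-≤ 2 1≤r) (+-mono-≤ (<⇒≤ light-xy) (+-mono-≤ (<⇒≤ few-x) (<⇒≤ few-y))) ⟩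
              2 * r + (r + (2 * r + 2 * r)) ≡⟨ regroup r ⟩
              7 * r ∎) U-large
              where
              regroup : ∀ r → 2 * r + (r + (2 * r + 2 * r)) ≡ 7 * r
              regroup = solve-∀
          ... | z , z∈ , z∉ with z≢x | z≢y | xyz | xz-light | yz-light
            where
            z≢x : z ≢ x
            z≢x e = z∉ (here e)
            z≢y : z ≢ y
            z≢y e = z∉ (there (here e))
            xyz : f x y z ≡ γ
            xyz = Opposite.force-γ β≢γ λ e →
              z∉ (there (there (∈-++⁺ˡ (∈-N⁺ z∈ z≢x z≢y e))))
            xz-light : codegree γ x z < r
            xz-light = ∉heavy⇒light z∈ (≢-sym z≢x) λ h →
              z∉ (there (there (∈-++⁺ʳ (N x y β U) (∈-++⁺ˡ h))))
            yz-light : codegree γ y z < r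
            yz-light = ∉heavy⇒light z∈ (≢-sym z≢y) λ h →
              z∉ (there (there (∈-++⁺ʳ (N x y β U) (∈-++⁺ʳ (heavy γ x) h))))
          ...   | z≢x | z≢y | xyz | xz-light | yz-light
              with pick-outside _≟_ (x ∷ y ∷ z ∷ N x y β U ++ N x z γ U ++ N y z γ U) uU fits
            where
            fits : length (x ∷ y ∷ z ∷ N x y β U ++ N x z γ U ++ N y z γ U) < length U
            fits = ≤-<-trans (begin
              3 + length (N x y β U ++ N x z γ U ++ N y z γ U)
                ≡⟨ cong (3 +_) (trans (length-++ (N x y β U)) (cong (codegree β x y +_) (length-++ (N x z γ U)))) ⟩
              3 + (codegree β x y + (codegree γ x z + codegree γ y z))
                ≤⟨ +-mono-≤ (*-monoʳ-≤ 3 1≤r) (+-mono-≤ (<⇒≤ light-xy) (+-mono-≤ (<⇒≤ xz-light) (<⇒≤ yz-light))) ⟩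
              3 * r + (r + (r + r)) ≡⟨ regroup r ⟩
              6 * r ≤⟨ *-monoˡ-≤ r (m≤m+n 6 1) ⟩
              7 * r ∎) U-large
              where
              regroup : ∀ r → 3 * r + (r + (r + r)) ≡ 6 * r
              regroup = solve-∀
          ...     | w , w∈ , w∉ = D₂-free β≢γ x≢y (≢-sym z≢x) (≢-sym w≢x) (≢-sym z≢y) (≢-sym w≢y) (≢-sym w≢z)
              xyz
              (Opposite.force-γ β≢γ λ e → w∉ (there (there (there (∈-++⁺ˡ (∈-N⁺ w∈ w≢x w≢y e))))))
              (Opposite.force-β β≢γ λ e → w∉ (there (there (there (∈-++⁺ʳ (N x y β U)
                (∈-++⁺ˡ (∈-N⁺ w∈ w≢x w≢z e)))))))
              (Opposite.force-β β≢γ λ e → w∉ (there (there (there (∈-++⁺ʳ (N x y β U)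
                (∈-++⁺ʳ (N x z γ U) (∈-N⁺ w∈ w≢y w≢z e)))))))
            where
            w≢x : w ≢ x
            w≢x e = w∉ (here e)
            w≢y : w ≢ y
            w≢y e = w∉ (there (here e))
            w≢z : w ≢ z
            w≢z e = w∉ (there (there (here e)))

      SparseHalf : Set
      SparseHalf = ∃[ γ ] Σ[ W ∈ List V ] (W ⊆ U × Unique W × length U ≤ length W + length W ×
        (∀ {x y} → x ∈ W → y ∈ W → x ≢ y → length (N x y γ W) ≤ r))

      -- By `few-heavy` each vertex has few heavy partners in some colour. On the larger of the two
      -- classes `no-heavy-pair` bounds every codegree in that colour.
      sparse-half : 7 * r < length U → SparseHalf
      sparse-half U-large = conclude (halve (filter-cover (few? true) (few? false) U few-heavy))
        where
        few? : ∀ γ → Decidable (λ x → length (heavy γ x) < 2 * r)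
        few? γ x = length (heavy γ x) <? 2 * r

        halve : length U ≤ length (filter (few? true) U) + length (filter (few? false) U) →
                ∃[ γ ] length U ≤ length (filter (few? γ) U) + length (filter (few? γ) U)
        halve le with ≤-total (length (filter (few? true) U)) (length (filter (few? false) U))
        ... | inj₁ t≤f = false , ≤-trans le (+-monoˡ-≤ _ t≤f)
        ... | inj₂ f≤t = true  , ≤-trans le (+-monoʳ-≤ _ f≤t)

        conclude : ∃[ γ ] length U ≤ length (filter (few? γ) U) + length (filter (few? γ) U) → SparseHalf
        conclude (γ , le) = γ , filter (few? γ) U , filter-⊆ (few? γ) U , Unique.filter⁺ (few? γ) uU , le , light
          where
          light : x ∈ filter (few? γ) U → y ∈ filter (few? γ) U → x ≢ y →
                  length (N x y γ (filter (few? γ) U)) ≤ r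
          light {x} {y} x∈ y∈ x≢y with ∈-filter⁻ (few? γ) {xs = U} x∈ | ∈-filter⁻ (few? γ) {xs = U} y∈
          ... | x∈U , few-x | y∈U , few-y = ≤-trans
            (codegree-⊆ (filter-⊆ (few? γ) U) (Unique.filter⁺ (few? γ) uU))
            (<⇒≤ (no-heavy-pair {not γ} {γ} (≢-sym (not-¬ refl)) U-large x∈U y∈U x≢y few-x few-y))

    -- Product bounds and joining along a pair.

    module _ (s : ℕ) where

      LargeMono : Set
      LargeMono = ∃[ β ] ∃[ X ] (Unique X × Mono β X × s ≤ length X)

      -- The product of the sizes of an independent set and a clique in U is at least m / n.
      record MonoSets (U : List V) (m n : ℕ) : Set where
        constructor monoSets
        field
          sets   : Bool → List V
          unique : ∀ β → Unique (sets β)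
          within : ∀ β → sets β ⊆ U
          mono   : ∀ β → Mono β (sets β)
          bound  : m ≤ n * (length (sets true) * length (sets false))

      -- The number `s` is the target size. Finding a set that large ends the search; otherwise the
      -- chosen sets have fewer than `s` vertices, which keeps the loss in `join` below `s * s`.
      Result : List V → ℕ → ℕ → Set
      Result U m n = LargeMono ⊎ MonoSets U m n

      result-⊆ : U ⊆ W → Result U m n → Result W m n
      result-⊆ U⊆W = map₂ λ (monoSets I u i mono le) → monoSets I u (λ β → U⊆W ∘ i β) mono le

      result-weaken : ∀ {m m′ n} → m′ ≤ m → Result U m n → Result U m′ n
      result-weaken m′≤m = map₂ λ (monoSets I u i mono le) → monoSets I u i mono (≤-trans m′≤m le)

      result-scale : ∀ k → Result U m n → Result U (k * m) (k * n)
      result-scale {n = n} k = map₂ λ (monoSets I u i mono le) → monoSets I u i mono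
        (≤-trans (*-monoʳ-≤ k le) (≤-reflexive (sym (*-assoc k n _))))

      result-cancel : ∀ k .{{_ : NonZero k}} → Result U (k * m) (k * n) → Result U m n
      result-cancel {n = n} k = map₂ λ (monoSets I u i mono le) → monoSets I u i mono
        (*-cancelˡ-≤ k (≤-trans le (≤-reflexive (*-assoc k n _))))

      -- One vertex is monochromatic in both colours and gives product 1; the empty list gives only
      -- product 0.
      result-trivial : (∀ {v} → v ∈ U → m ≤ n) → (U ≡ [] → m ≡ 0) → Result U m n
      result-trivial {U = []} _ empty rewrite empty refl =
        inj₂ (monoSets (λ _ → []) (λ _ → []) (λ _ ()) (λ _ → mono-[]) z≤n)
      result-trivial {U = v ∷ U} nonempty _ = inj₂ (monoSets (λ _ → v ∷ []) (λ _ → [] ∷ [])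
        (λ { _ (here e) → here e }) (λ _ → mono-[_] v)
        (≤-trans (nonempty (here refl)) (≤-reflexive (sym (*-identityʳ _)))))

      private
        longer : List V → List V → List V
        longer X Y with length X ≤? length Y
        ... | yes _ = Y
        ... | no  _ = X

        longer-ˡ : ∀ X Y → length X ≤ length (longer X Y)
        longer-ˡ X Y with length X ≤? length Y
        ... | yes p = p
        ... | no  _ = ≤-refl

        longer-ʳ : ∀ X Y → length Y ≤ length (longer X Y)
        longer-ʳ X Y with length X ≤? length Y
        ... | yes _ = ≤-refl
        ... | no  p = <⇒≤ (≰⇒> p)

        longer-elim : (P : List V → Set) → ∀ {X Y} → P X → P Y → P (longer X Y)
        longer-elim P {X} {Y} pX pY with length X ≤? length Y
        ... | yes _ = pY
        ... | no  _ = pX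

        monoSets-from : ∀ β {X Y} → Unique X → X ⊆ U → Mono β X →
                        Unique Y → Y ⊆ U → Mono (not β) Y →
                        m ≤ n * (length X * length Y) → MonoSets U m n
        monoSets-from true {X} {Y} uX X⊆ mX uY Y⊆ mY le = monoSets (λ { true → X ; false → Y })
          (λ { true → uX ; false → uY }) (λ { true → X⊆ ; false → Y⊆ }) (λ { true → mX ; false → mY }) le
        monoSets-from {n = n} false {X} {Y} uX X⊆ mX uY Y⊆ mY le = monoSets (λ { true → Y ; false → X })
          (λ { true → uY ; false → uX }) (λ { true → Y⊆ ; false → X⊆ }) (λ { true → mY ; false → mX })
          (≤-trans le (≤-reflexive (cong (n *_) (*-comm (length X) (length Y)))))

        size-at : (β : Bool) (I : Bool → List V) →
                  length (I true) * length (I false) ≡ length (I β) * length (I (not β))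
        size-at true  I = refl
        size-at false I = *-comm (length (I true)) (length (I false))

      -- Two different exceptions `a`, `a′` to the same pair `b`, `b′` would form a bad four-set
      -- with it, because the triples `a a′ b` and `a a′ b′` have colour `β`.
      pair-nbr-unique : Pair β A B → β ≢ γ → a ∈ A → a′ ∈ A → b ∈ B → b′ ∈ B → b ≢ b′ →
                        f b b′ a ≡ γ → f b b′ a′ ≡ γ → a ≡ a′
      pair-nbr-unique {a = a} {a′} (AAB , A≢B) β≢γ a∈ a′∈ b∈ b′∈ b≢b′ bb′a bb′a′ with a ≟ a′
      ... | yes a≡a′ = a≡a′
      ... | no  a≢a′ = ⊥-elim (D₂-free β≢γ b≢b′ (≢-sym (A≢B a∈ b∈)) (≢-sym (A≢B a′∈ b∈))
        (≢-sym (A≢B a∈ b′∈)) (≢-sym (A≢B a′∈ b′∈)) a≢a′ bb′a bb′a′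
        (rot² (AAB a∈ a′∈ b∈ a≢a′)) (rot² (AAB a∈ a′∈ b′∈ a≢a′)))

      -- The set chosen in B is fixed first; it forbids at most one vertex of A per pair, so
      -- the set chosen in A can be taken inside a slightly smaller A′.
      join : Pair β A B → A ⊆ U → B ⊆ U → Unique A → ∀ {m₁ m₂ n} → Result B m₂ n →
             (∀ {A′} → A′ ⊆ A → Unique A′ → length A ≤ length A′ + s * s → Result A′ m₁ n) →
             Result U (m₁ + m₂) n
      join _ _ _ _ (inj₁ large) _ = inj₁ large
      join {β} {A} {B} {U} pair A⊆U B⊆U uA {m₁} {m₂} {n} (inj₂ (monoSets J uJ J⊆B mJ leJ)) solveA with s ≤? length (J β)
      ... | yes s≤ = inj₁ (β , J β , uJ β , mJ β , s≤)
      ... | no s≰ = map₂ combine (solveA A′⊆A (Unique.filter⁺ good? uA) A′-large)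
        where
        hits? : ∀ b b′ → Decidable (λ a → b ≢ b′ × f b b′ a ≡ not β)
        hits? b b′ a = ¬? (b ≟ b′) ×-dec (f b b′ a ≟ᵇ not β)
        hits : V → V → List V
        hits b b′ = filter (hits? b b′) A
        F = concatMap₂ hits (J β)
        good? : Decidable (_∉ F)
        good? a = ¬? (a ∈? F)
        A′ = filter good? A
        A′⊆A : A′ ⊆ A
        A′⊆A = filter-⊆ good? A

        F-small : length F ≤ s * s
        F-small = begin
          length F                                ≤⟨ length-concatMap₂-≤ hits (J β) one ⟩
          length (J β) * (length (J β) * 1)       ≡⟨ cong (length (J β) *_) (*-identityʳ _) ⟩
          length (J β) * length (J β)             ≤⟨ *-mono-≤ (<⇒≤ (≰⇒> s≰)) (<⇒≤ (≰⇒> s≰)) ⟩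
          s * s                                   ∎
          where
          open ≤-Reasoning
          one : ∀ {b b′} → b ∈ J β → b′ ∈ J β → length (hits b b′) ≤ 1
          one {b} {b′} b∈ b′∈ = subsingleton⇒length≤1 (Unique.filter⁺ (hits? b b′) uA) λ a∈ a′∈ →
            let a∈A , b≢b′ , e = ∈-filter⁻ (hits? b b′) a∈ ; a′∈A , _ , e′ = ∈-filter⁻ (hits? b b′) a′∈ in
            pair-nbr-unique pair (not-¬ refl) a∈A a′∈A (J⊆B β b∈) (J⊆B β b′∈) b≢b′ e e′

        A′-large : length A ≤ length A′ + s * s
        A′-large = ≤-trans (length-∉-filter _≟_ F uA) (+-monoʳ-≤ (length A′) F-small)

        combine : MonoSets A′ m₁ n → MonoSets U (m₁ + m₂) n
        combine (monoSets I uI I⊆A′ mI leI) = monoSets-from {n = n} β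
          (Unique.++⁺ (uI β) (uJ β) λ (v∈I , v∈J) → proj₂ pair (I⊆A β v∈I) (J⊆B β v∈J) refl)
          (λ v∈ → [ A⊆U ∘ I⊆A β , B⊆U ∘ J⊆B β ]′ (∈-++⁻ (I β) v∈))
          (mono-++ (mI β) (mJ β)
            (λ a∈ a′∈ b∈ → proj₁ pair (I⊆A β a∈) (I⊆A β a′∈) (J⊆B β b∈)) ABB)
          (longer-elim Unique (uI (not β)) (uJ (not β)))
          (longer-elim (_⊆ U) (A⊆U ∘ I⊆A (not β)) (B⊆U ∘ J⊆B (not β)))
          (longer-elim (Mono (not β)) (mI (not β)) (mJ (not β)))
          sizes
          where
          I⊆A : ∀ β → I β ⊆ A
          I⊆A β = A′⊆A ∘ I⊆A′ β

          ABB : ∀ {a b b′} → a ∈ I β → b ∈ J β → b′ ∈ J β → b ≢ b′ → f b b′ a ≡ β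
          ABB {a} {b} {b′} a∈ b∈ b′∈ b≢b′ with ≢-dichotomy (not-¬ {β} refl) (f b b′ a)
          ... | inj₁ e = e
          ... | inj₂ e = ⊥-elim (proj₂ (∈-filter⁻ good? {xs = A} (I⊆A′ β a∈))
                           (∈-concatMap₂ hits (J β) b∈ b′∈ (∈-filter⁺ (hits? b b′) (I⊆A β a∈) (b≢b′ , e))))

          open ≤-Reasoning
          i = length (I β)
          j = length (J β)
          i′ = length (I (not β))
          j′ = length (J (not β))
          k = length (longer (I (not β)) (J (not β)))
          -- Superadditivity of the product: the `β`-sets are united and the longer set of the other
          -- colour is kept, and `(i + j) * k` is at least `i * i′ + j * j′` when `k` bounds both
          -- `i′` and `j′`.
          sizes : m₁ + m₂ ≤ n * (length (I β ++ J β) * k)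
          sizes = begin
            m₁ + m₂                            ≤⟨ +-mono-≤ leI leJ ⟩
            n * (length (I true) * length (I false)) + n * (length (J true) * length (J false))
                                               ≡⟨ cong₂ (λ p q → n * p + n * q) (size-at β I) (size-at β J) ⟩
            n * (i * i′) + n * (j * j′)        ≡⟨ sym (*-distribˡ-+ n (i * i′) (j * j′)) ⟩
            n * (i * i′ + j * j′)              ≤⟨ *-monoʳ-≤ n (+-mono-≤
                                                    (*-monoʳ-≤ i (longer-ˡ (I (not β)) (J (not β))))
                                                    (*-monoʳ-≤ j (longer-ʳ (I (not β)) (J (not β))))) ⟩
            n * (i * k + j * k)                ≡⟨ cong (n *_) (sym (*-distribʳ-+ k i j)) ⟩
            n * ((i + j) * k)                  ≡⟨ cong (λ l → n * (l * k)) (sym (length-++ (I β))) ⟩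
            n * (length (I β ++ J β) * k)      ∎

      -- Greedy growth and pairs with two large sides.

      -- Vertices are added one at a time. Each ordered pair already chosen forbids at most `t`
      -- vertices, and fewer than `s` vertices are chosen before the end, so `s * s * suc t`
      -- vertices always leave a free one.
      greedy : β ≢ γ → Unique W → ∀ t → s * s * suc t ≤ length W →
               (∀ {x y} → x ∈ W → y ∈ W → x ≢ y → length (N x y γ W) ≤ t) →
               LargeMono
      greedy {β} {γ} {W} β≢γ uW t big codegree with grow s ≤-refl
        where
        hits? : ∀ b b′ → Decidable (λ w → b ≢ b′ × Nbr b b′ γ w)
        hits? b b′ w = ¬? (b ≟ b′) ×-dec nbr? b b′ γ w
        hits : V → V → List V
        hits b b′ = filter (hits? b b′) W

        hits-≤ : b ∈ W → b′ ∈ W → length (hits b b′) ≤ t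
        hits-≤ {b} {b′} b∈ b′∈ = by-cases (b ≟ b′)
          where
          by-cases : Dec (b ≡ b′) → length (hits b b′) ≤ t
          by-cases (yes b≡b′) = ≤-trans (⊆⇒length≤ {ys = []} (Unique.filter⁺ (hits? b b′) uW) λ w∈ →
            ⊥-elim (proj₁ (proj₂ (∈-filter⁻ (hits? b b′) {xs = W} w∈)) b≡b′)) z≤n
          by-cases (no b≢b′) = ≤-trans
            (⊆⇒length≤ (Unique.filter⁺ (hits? b b′) uW) λ w∈ →
              let w∈W , _ , nbr = ∈-filter⁻ (hits? b b′) {xs = W} w∈ in ∈-filter⁺ (nbr? b b′ γ) w∈W nbr)
            (codegree b∈ b′∈ b≢b′)

        grow : ∀ j → j ≤ s → ∃[ X ] (Unique X × X ⊆ W × Mono β X × length X ≡ j)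
        grow zero    _   = [] , [] , (λ ()) , mono-[] , refl
        grow (suc j) j<s with grow j (<⇒≤ j<s)
        ... | X , uX , X⊆W , mono , refl with pick-outside _≟_ (X ++ concatMap₂ hits X) uW fits
          where
          open ≤-Reasoning
          l = length X
          fits : length (X ++ concatMap₂ hits X) < length W
          fits = begin-strict
            length (X ++ concatMap₂ hits X)       ≡⟨ length-++ X ⟩
            l + length (concatMap₂ hits X)        ≤⟨ +-monoʳ-≤ l (length-concatMap₂-≤ hits X λ p q → hits-≤ (X⊆W p) (X⊆W q)) ⟩
            l + l * (l * t)                       <⟨ +-monoˡ-< _ (n<1+n l) ⟩
            suc l + l * (l * t)                   ≤⟨ +-mono-≤ (m≤m*n (suc l) (suc l)) (*-mono-≤ (n≤1+n l) (*-monoˡ-≤ t (n≤1+n l))) ⟩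
            suc l * suc l + suc l * (suc l * t)   ≡⟨ expand (suc l) t ⟩
            suc l * suc l * suc t                 ≤⟨ *-monoˡ-≤ (suc t) (*-mono-≤ j<s j<s) ⟩
            s * s * suc t                         ≤⟨ big ⟩
            length W                              ∎
            where
            expand : ∀ k t → k * k + k * (k * t) ≡ k * k * suc t
            expand = solve-∀
        ...   | v , v∈W , v∉ = v ∷ X , All.tabulate (λ x∈ → λ { refl → v∉ (∈-++⁺ˡ x∈) }) ∷ uX
              , (λ { (here refl) → v∈W ; (there x∈) → X⊆W x∈ })
              , mono-++ {A = v ∷ []} (mono-[_] v) mono
                  (λ { (here refl) (here refl) _ v≢v → ⊥-elim (v≢v refl) }) vXX
              , refl
          where
          vXX : a ∈ v ∷ [] → b ∈ X → b′ ∈ X → b ≢ b′ → f b b′ a ≡ β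
          vXX {b = b} {b′} (here refl) b∈ b′∈ b≢b′ with ≢-dichotomy β≢γ (f b b′ v)
          ... | inj₁ e = e
          ... | inj₂ e = ⊥-elim (v∉ (∈-++⁺ʳ X (∈-concatMap₂ hits X b∈ b′∈ (∈-filter⁺ (hits? b b′) v∈W
            (b≢b′ , (λ { refl → v∉ (∈-++⁺ˡ b∈) }) , (λ { refl → v∉ (∈-++⁺ˡ b′∈) }) , e)))))
      ... | X , uX , _ , mono , refl = β , X , uX , mono , ≤-refl

      BalancedPair : ℕ → List V → Set
      BalancedPair h U = ∃[ β ] ∃[ A ] ∃[ B ]
        (Pair β A B × A ⊆ U × B ⊆ U × Unique A × Unique B × h ≤ length A × h ≤ length B)

      -- Either many γ-neighbours z of y in the link of x have at least h γ-neighbours in Q, and the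
      -- smallest of these neighbourhoods is one side of the pair, or many have at least h
      -- β-neighbours in Q, and the β-neighbours of the z with fewest of them are one side.
      balanced-pair : β ≢ γ → x ≢ y → Unique U → ∀ {h} → 1 ≤ h →
                      h + h ≤ length (N x y γ U) → h + h ≤ length (N x y β U) →
                      BalancedPair h U
      balanced-pair {β} {γ} {x} {y} {U} β≢γ x≢y uU {h} 1≤h leP leQ =
        [ rich , poor ]′ (+-split-≤ (length P₁) (length P₂) (≤-trans leP (filter-cover rich? poor? P λ {z} _ → rich⊎poor z)))
        where
        P = N x y γ U
        Q = N x y β U
        link : Bool → V → List V
        link δ z = filter (λ q → f x z q ≟ᵇ δ) Q
        link-⊆Q : ∀ δ z → link δ z ⊆ Q
        link-⊆Q δ z = filter-⊆ (λ q → f x z q ≟ᵇ δ) Q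
        Rich Poor : V → Set
        Rich z = h ≤ length (link γ z)
        Poor z = h ≤ length (link β z)
        rich? : Decidable Rich
        rich? z = h ≤? length (link γ z)
        poor? : Decidable Poor
        poor? z = h ≤? length (link β z)
        rich⊎poor : ∀ z → Rich z ⊎ Poor z
        rich⊎poor z = +-split-≤ (length (link γ z)) (length (link β z))
          (≤-trans leQ (filter-cover (λ q → f x z q ≟ᵇ γ) (λ q → f x z q ≟ᵇ β) Q
            λ {q} _ → ≢-dichotomy (≢-sym β≢γ) (f x z q)))
        P₁ = filter rich? P
        P₂ = filter poor? P
        P-nbr : z ∈ P → Nbr x y γ z
        P-nbr z∈ = proj₂ (∈-N⁻ {U = U} z∈)
        Q-nbr : z ∈ Q → Nbr x y β z
        Q-nbr z∈ = proj₂ (∈-N⁻ {U = U} z∈)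
        P⊆U : P ⊆ U
        P⊆U = filter-⊆ (nbr? x y γ) U
        Q⊆U : Q ⊆ U
        Q⊆U = filter-⊆ (nbr? x y β) U
        uP : Unique P
        uP = Unique.filter⁺ (nbr? x y γ) uU
        uQ : Unique Q
        uQ = Unique.filter⁺ (nbr? x y β) uU

        rich : h ≤ length P₁ → BalancedPair h U
        rich le with link-min β≢γ x≢y P-nbr Q-nbr sub (proj₂ (nonempty⇒∈ (≤-trans 1≤h le)))
          where
          sub : P₁ ⊆ P
          sub = filter-⊆ rich? P
        ... | m , m∈ , pair =
          γ , link γ m , P₁ , pair , Q⊆U ∘ link-⊆Q γ m , P⊆U ∘ sub , Unique.filter⁺ _ uQ
          , Unique.filter⁺ rich? uP , proj₂ (∈-filter⁻ rich? {xs = P} m∈) , le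
          where
          sub : P₁ ⊆ P
          sub = filter-⊆ rich? P

        poor : h ≤ length P₂ → BalancedPair h U
        poor le with link-max β≢γ x≢y P-nbr Q-nbr sub (proj₂ (nonempty⇒∈ (≤-trans 1≤h le)))
          where
          sub : P₂ ⊆ P
          sub = filter-⊆ poor? P
        ... | m , m∈ , pair =
          β , P₂ , link β m , pair , P⊆U ∘ sub , Q⊆U ∘ link-⊆Q β m , Unique.filter⁺ poor? uP
          , Unique.filter⁺ _ uQ , le , proj₂ (∈-filter⁻ poor? {xs = P} m∈)
          where
          sub : P₂ ⊆ P
          sub = filter-⊆ poor? P

      -- Doubling the product bound.

      module _ .{{_ : NonZero s}} where

        -- From this size on, codegrees at most 2s² allow a greedy choice of s vertices.
        baseSize : ℕ
        baseSize = s * s * suc (2 * (s * s))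

        -- The induction hypothesis `solve-small` guarantees a product of at least
        -- `length A * g / q`. Being linear in the size, the guarantee adds up over the two sides of
        -- a `join`.
        module Step {q g : ℕ} (q-large : baseSize * g ≤ q) (1≤g : 1 ≤ g)
                    (solve-small : ∀ {A} → Unique A → length A ≤ q → Result A (length A * g) q) where

          1≤s*s : 1 ≤ s * s
          1≤s*s = *-mono-≤ (>-nonZero⁻¹ s) (>-nonZero⁻¹ s)

          s*s≤q : s * s ≤ q
          s*s≤q = begin
            s * s          ≤⟨ m≤m*n (s * s) (suc (2 * (s * s))) ⟩
            baseSize       ≡⟨ sym (*-identityʳ _) ⟩
            baseSize * 1   ≤⟨ *-monoʳ-≤ baseSize 1≤g ⟩
            baseSize * g   ≤⟨ q-large ⟩
            q              ∎
            where open ≤-Reasoning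

          1≤q : 1 ≤ q
          1≤q = ≤-trans 1≤s*s s*s≤q

          solve-q : Unique A → q ≤ length A → Result A (q * g) q
          solve-q {A} uA q≤ = result-⊆ (take-⊆ q A)
            (subst (λ l → Result (take q A) (l * g) q) len
              (solve-small (Unique.take⁺ q uA) (≤-reflexive len)))
            where
            len : length (take q A) ≡ q
            len = length-take-≤ q A q≤

          -- Above size `q`, any `q` of the vertices already give product `g`, enough for the weaker
          -- slope `g / (4q)`.
          solve-4q : Unique A → length A ≤ 4 * q → Result A (length A * g) (4 * q)
          solve-4q {A} uA le with length A ≤? q
          ... | yes p = result-weaken (m≤n*m (length A * g) 4) (result-scale 4 (solve-small uA p))
          ... | no ¬p = result-weaken
            (≤-trans (*-monoˡ-≤ g le) (≤-reflexive (*-assoc 4 q g)))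
            (result-scale 4 (solve-q uA (<⇒≤ (≰⇒> ¬p))))

          -- Here `2 + 2 * d` counts the vertices that `sparse-pair` allows to be lost from `W`
          -- besides `M`. Since `d` exceeds `2 * (s * s)`, the list `A` keeps at least half of the
          -- `d` vertices, so the charge is at most `6 * length A`, which the factor 8 covers.
          solve-inside : ∀ {d} → 2 * (s * s) < d → Unique A → length A ≤ 4 * q → d ≤ length A + s * s →
                         Result A ((2 + 2 * d) * g) (8 * (4 * q))
          solve-inside {A} {d} rich uA A≤ d≤ = result-weaken bound (result-scale 8 (solve-4q uA A≤))
            where
            open ≤-Reasoning
            l = length A
            double : d + d ≤ 2 * l + d
            double = begin
              d + d                            ≤⟨ +-mono-≤ d≤ d≤ ⟩
              (l + s * s) + (l + s * s)        ≡⟨ regroup l (s * s) ⟩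
              2 * l + 2 * (s * s)              ≤⟨ +-monoʳ-≤ (2 * l) (<⇒≤ rich) ⟩
              2 * l + d                        ∎
              where
              regroup : ∀ l t → (l + t) + (l + t) ≡ 2 * l + 2 * t
              regroup = solve-∀
            d≤2l : d ≤ 2 * l
            d≤2l = +-cancelʳ-≤ d d (2 * l) double
            2≤2l : 2 ≤ 2 * l
            2≤2l = ≤-trans (≤-trans (*-monoʳ-≤ 2 1≤s*s) (<⇒≤ rich)) d≤2l
            bound : (2 + 2 * d) * g ≤ 8 * (l * g)
            bound = begin
              (2 + 2 * d) * g             ≤⟨ *-monoˡ-≤ g (+-mono-≤ 2≤2l (*-monoʳ-≤ 2 d≤2l)) ⟩
              (2 * l + 2 * (2 * l)) * g   ≡⟨ regroup l g ⟩
              6 * (l * g)                 ≤⟨ *-monoˡ-≤ (l * g) (m≤m+n 6 2) ⟩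
              8 * (l * g)                 ∎
              where
              regroup : ∀ l g → (2 * l + 2 * (2 * l)) * g ≡ 6 * (l * g)
              regroup = solve-∀

          -- Below `baseSize` one vertex suffices by `q-large`, and if all codegrees are at most
          -- `2 * (s * s)` then `greedy` finishes. Otherwise a neighbourhood is split off,
          -- `solve-inside` pays for the vertices lost, and the recursion continues on `M`. The
          -- bound `k` on the length makes this structural.
          solve-sparse : β ≢ γ → ∀ k → length W ≤ k → Unique W →
                         (∀ {x y} → x ∈ W → y ∈ W → x ≢ y → length (N x y γ W) ≤ 4 * q) →
                         Result W (length W * g) (8 * (4 * q))
          solve-sparse {W = []} _ _ _ _ _ = result-trivial (λ ()) (λ _ → refl)
          solve-sparse {β} {γ} {W@(_ ∷ _)} β≢γ (suc k) W≤k uW sparse with baseSize ≤? length W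
          ... | no small = result-trivial (λ _ → bound) (λ ())
            where
            open ≤-Reasoning
            bound : length W * g ≤ 8 * (4 * q)
            bound = begin
              length W * g  ≤⟨ *-monoˡ-≤ g (<⇒≤ (≰⇒> small)) ⟩
              baseSize * g  ≤⟨ q-large ⟩
              q             ≤⟨ m≤n*m q 4 ⟩
              4 * q         ≤⟨ m≤n*m (4 * q) 8 ⟩
              8 * (4 * q)   ∎
          ... | yes large with any? (λ x → any? (λ y → ¬? (x ≟ y) ×-dec (2 * (s * s) <? length (N x y γ W))) W) W
          ...   | no none = inj₁ (greedy β≢γ uW (2 * (s * s)) large λ x∈ y∈ x≢y →
                    ≮⇒≥ λ lt → none (lose x∈ (lose y∈ (x≢y , lt))))
          ...   | yes some with find some
          ...     | x , x∈W , some′ with find some′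
          ...       | y₀ , y₀∈W , x≢y₀ , rich₀ with max-codegree {γ = γ} y₀∈W x≢y₀
          -- Passing from `y₀` to the best partner of `x` keeps the codegree above `2 * (s * s)`.
          ...         | y , y∈W , x≢y , max with <-≤-trans rich₀ (max y₀∈W x≢y₀)
          ...           | rich with sparse-pair β≢γ uW x∈W x≢y (≤-trans (s≤s z≤n) rich) max
          ...             | M , pair , M⊆W , uM , M<W , W-cover = result-weaken
            (≤-trans (*-monoˡ-≤ g W-cover) (≤-reflexive (*-distribʳ-+ g (2 + 2 * length (N x y γ W)) (length M))))
            (join pair P⊆W M⊆W (Unique.filter⁺ (nbr? x y γ) uW)
              (solve-sparse β≢γ k (s≤s⁻¹ (<-≤-trans M<W W≤k)) uM λ x∈ y∈ x≢y →
                ≤-trans (codegree-⊆ M⊆W uM) (sparse (M⊆W x∈) (M⊆W y∈) x≢y))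
              λ A⊆P uA → solve-inside rich uA (≤-trans (⊆⇒length≤ uA A⊆P) (sparse x∈W y∈W x≢y)))
            where
            P⊆W : N x y γ W ⊆ W
            P⊆W = filter-⊆ (nbr? x y γ) W

        module _ {q g : ℕ} (q-large : baseSize * g ≤ q) (1≤g : 1 ≤ g)
                 (solve-small : ∀ {A} → Unique A → length A ≤ q → Result A (length A * g) q) where
          open Step q-large 1≤g solve-small

          private instance
            q-nonZero : NonZero q
            q-nonZero = >-nonZero 1≤q

          -- Of the `2 * q` vertices in `A`, `join` removes at most `s * s`, hence at most `q`. At
          -- least `q` remain on each side, and each side contributes `g`.
          pair-doubles : BalancedPair (2 * q) U → Result U (2 * g) 1
          pair-doubles {U} (β , A , B , pair , A⊆U , B⊆U , uA , uB , A-large , B-large) =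
            result-cancel q (subst (Result U (q * (2 * g))) (sym (*-identityʳ q))
              (result-weaken (≤-reflexive (regroup q g))
                (join pair A⊆U B⊆U uA (solve-q uB (≤-trans (m≤n*m q 2) B-large)) λ {A′} _ uA′ A≤ →
                  solve-q uA′ (+-cancelʳ-≤ q q (length A′) (begin
                    q + q                    ≡⟨ cong (q +_) (sym (+-identityʳ q)) ⟩
                    2 * q                    ≤⟨ A-large ⟩
                    length A                 ≤⟨ A≤ ⟩
                    length A′ + s * s        ≤⟨ +-monoʳ-≤ (length A′) s*s≤q ⟩
                    length A′ + q            ∎)))))
            where
            open ≤-Reasoning
            regroup : ∀ q g → q * (2 * g) ≡ q * g + q * g
            regroup = solve-∀

          -- The threshold is `4 * q` because `balanced-pair` halves it and `pair-doubles` wants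
          -- sides of size `2 * q`.
          Balanced : List V → V → V → Set
          Balanced U x y = x ≢ y × 4 * q ≤ length (N x y true U) × 4 * q ≤ length (N x y false U)

          balanced? : ∀ U x → Decidable (Balanced U x)
          balanced? U x y = ¬? (x ≟ y) ×-dec (4 * q ≤? length (N x y true U)) ×-dec (4 * q ≤? length (N x y false U))

          balanced⇒doubles : Unique U → ∀ {x y} → Balanced U x y → Result U (2 * g) 1
          balanced⇒doubles {U} uU (x≢y , le-true , le-false) = pair-doubles
            (balanced-pair {β = false} {γ = true} (λ ()) x≢y uU (≤-trans 1≤q (m≤n*m q 2))
              (≤-trans (≤-reflexive (regroup q)) le-true) (≤-trans (≤-reflexive (regroup q)) le-false))
            where
            regroup : ∀ q → 2 * q + 2 * q ≡ 4 * q
            regroup = solve-∀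

          -- The slope from `solve-sparse` is `g / (32q)`, so `64 * q` vertices give `2 * g`; half
          -- of `128 * q` provides them.
          sparse⇒doubles : 128 * q ≤ length U → length U ≤ length W + length W → Unique W →
                           ∀ {γ} → (∀ {x y} → x ∈ W → y ∈ W → x ≢ y → length (N x y γ W) ≤ 4 * q) →
                           Result W (2 * g) 1
          sparse⇒doubles {U} {W} U-large U≤2W uW {γ} sparse =
            result-cancel (8 * (4 * q)) {{m*n≢0 8 (4 * q) {{_}} {{m*n≢0 4 q}}}}
              (subst (Result W (8 * (4 * q) * (2 * g))) (sym (*-identityʳ (8 * (4 * q))))
                (result-weaken bound
                  (solve-sparse {β = not γ} (≢-sym (not-¬ refl)) (length W) ≤-refl uW sparse)))
            where
            open ≤-Reasoning
            regroup : ∀ q g → 8 * (4 * q) * (2 * g) ≡ (64 * q) * g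
            regroup q g = trans (cong (_* (2 * g)) (sym (*-assoc 8 4 q)))
              (trans ([m*n]*[o*p]≡[m*o]*[n*p] 32 q 2 g) (sym (*-assoc 64 q g)))
            64q≤W : 64 * q ≤ length W
            64q≤W = *-cancelˡ-≤ 2 (begin
              2 * (64 * q)            ≡⟨ sym (*-assoc 2 64 q) ⟩
              128 * q                 ≤⟨ U-large ⟩
              length U                ≤⟨ U≤2W ⟩
              length W + length W     ≡⟨ cong (length W +_) (sym (+-identityʳ _)) ⟩
              2 * length W            ∎)
            bound : 8 * (4 * q) * (2 * g) ≤ length W * g
            bound = ≤-trans (≤-reflexive (regroup q g)) (*-monoˡ-≤ g 64q≤W)

          unbalanced⇒doubles : Unique U → 128 * q ≤ length U → (∀ {x y} → x ∈ U → y ∈ U → ¬ Balanced U x y) →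
                               Result U (2 * g) 1
          unbalanced⇒doubles {U} uU U-large none = from-half
            (Heavy.sparse-half uU {r = 4 * q} (≤-trans 1≤q (m≤n*m q 4)) polarised 7r<U)
            where
            open ≤-Reasoning
            polarised : ∀ {x y} → x ∈ U → y ∈ U → x ≢ y →
                        length (N x y true U) < 4 * q ⊎ length (N x y false U) < 4 * q
            polarised {x} {y} x∈ y∈ x≢y
              with 4 * q ≤? length (N x y true U) | 4 * q ≤? length (N x y false U)
            ... | no ¬p | _     = inj₁ (≰⇒> ¬p)
            ... | yes _ | no ¬q = inj₂ (≰⇒> ¬q)
            ... | yes p | yes q = ⊥-elim (none x∈ y∈ (x≢y , p , q))
            7r<U : 7 * (4 * q) < length U
            7r<U = begin-strict
              7 * (4 * q)   ≡⟨ sym (*-assoc 7 4 q) ⟩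
              28 * q        <⟨ *-monoˡ-< q (m≤m+n 29 99) ⟩
              128 * q       ≤⟨ U-large ⟩
              length U      ∎
            from-half : Heavy.SparseHalf uU {r = 4 * q} (≤-trans 1≤q (m≤n*m q 4)) polarised →
                        Result U (2 * g) 1
            from-half (γ , W , W⊆U , uW , U≤2W , sparse) =
              result-⊆ W⊆U (sparse⇒doubles {U = U} U-large U≤2W uW sparse)

          doubling : Unique U → 128 * q ≤ length U → Result U (2 * g) 1
          doubling {U} uU U-large = by-cases (any? (λ x → any? (balanced? U x) U) U)
            where
            by-cases : Dec (Any (λ x → Any (Balanced U x) U) U) → Result U (2 * g) 1
            by-cases (yes some) = balanced⇒doubles uU (proj₂ (proj₂ (find (proj₂ (proj₂ (find some))))))
            by-cases (no none)  = unbalanced⇒doubles uU U-large λ x∈ y∈ b → none (lose x∈ (lose y∈ b))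

          -- Re-establishes the hypothesis for `256 * q` and `2 * g`, with slope `g / (128q)`. Up to
          -- `q` vertices the old bound is stronger, up to `128 * q` the product `g` from `q`
          -- vertices is enough, and beyond that `doubling` applies.
          solve-256q : Unique A → length A ≤ 256 * q → Result A (length A * (2 * g)) (256 * q)
          solve-256q {A} uA A≤ with length A ≤? 128 * q | length A ≤? q
          ... | no big | _ = subst (Result A (length A * (2 * g))) (*-identityʳ (256 * q))
            (result-weaken (*-monoˡ-≤ (2 * g) A≤)
              (result-scale (256 * q) (doubling uA (<⇒≤ (≰⇒> big)))))
          ... | yes _ | yes small = result-weaken (≤-trans (≤-reflexive (regroup (length A) g))
              (*-monoˡ-≤ (length A * g) (m≤m+n 2 254)))
            (result-scale 256 (solve-small uA small))
            where
            regroup : ∀ l g → l * (2 * g) ≡ 2 * (l * g)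
            regroup = solve-∀
          ... | yes mid | no big = result-weaken
            (≤-trans (*-monoˡ-≤ (2 * g) mid) (≤-reflexive (regroup q g)))
            (result-scale 256 (solve-q uA (<⇒≤ (≰⇒> big))))
            where
            regroup : ∀ q g → 128 * q * (2 * g) ≡ 256 * (q * g)
            regroup q g = [m*n]*[o*p]≡[m*o]*[n*p] 128 q 2 g

        solve : ∀ k → Unique A → length A ≤ 256 ^ k * baseSize →
                Result A (length A * 2 ^ k) (256 ^ k * baseSize)
        solve {A} zero uA A≤ = result-trivial
          (λ _ → ≤-trans (≤-reflexive (*-identityʳ (length A))) A≤) (λ { refl → refl })
        solve {A} (suc k) uA A≤ = subst (Result A (length A * 2 ^ suc k)) (sym (*-assoc 256 (256 ^ k) base))
          (solve-256q q-large (^-monoʳ-≤ 2 (z≤n {k})) (solve k) uA (≤-trans A≤ (≤-reflexive (*-assoc 256 (256 ^ k) base))))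
          where
          base = baseSize
          q-large : base * 2 ^ k ≤ 256 ^ k * base
          q-large = ≤-trans (≤-reflexive (*-comm base (2 ^ k))) (*-monoˡ-≤ base (^-monoˡ-≤ k (m≤m+n 2 254)))

        -- After `k` doublings the product is at least `2 ^ k`, hence at least `s * s`, so its two
        -- factors cannot both be below `s`.
        large-mono : ∀ k → s * s ≤ 2 ^ k → Unique A → 256 ^ k * baseSize ≤ length A → LargeMono
        large-mono {A} k s*s≤2^k uA A-large = extract (result-cancel q
            (subst (Result (take q A) (q * 2 ^ k)) (sym (*-identityʳ q))
              (subst (λ l → Result (take q A) (l * 2 ^ k) q) len
                (solve k (Unique.take⁺ q uA) (≤-reflexive len)))))
          where
          q = 256 ^ k * baseSize
          instance
            base-nonZero : NonZero (baseSize)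
            base-nonZero = m*n≢0 (s * s) (suc (2 * (s * s))) {{m*n≢0 s s}}
            q-nonZero : NonZero q
            q-nonZero = m*n≢0 (256 ^ k) (baseSize) {{m^n≢0 256 k}}
          len : length (take q A) ≡ q
          len = length-take-≤ q A A-large

          extract : Result U (2 ^ k) 1 → LargeMono
          extract (inj₁ large) = large
          extract (inj₂ (monoSets I u _ mono le)) with s ≤? length (I true) | s ≤? length (I false)
          ... | yes p | _     = true  , I true  , u true  , mono true  , p
          ... | no _  | yes p = false , I false , u false , mono false , p
          ... | no ¬p | no ¬q = ⊥-elim (<⇒≱ (*-mono-< (≰⇒> ¬p) (≰⇒> ¬q))
            (≤-trans s*s≤2^k (≤-trans le (≤-reflexive (*-identityˡ _)))))

  -- Vertex lists and subsets.

  does-true⁻ : {A : Set} (a? : Dec A) → does a? ≡ true → A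
  does-true⁻ (yes a) _ = a

  does-false⁻ : {A : Set} (a? : Dec A) → does a? ≡ false → ¬ A
  does-false⁻ (no ¬a) _ = ¬a

  module _ {n : ℕ} where

    private variable
      x : Fin n
      xs : List (Fin n)
      p q : Subset n

    fromList : List (Fin n) → Subset n
    fromList = foldr (λ x p → ⁅ x ⁆ ∪ p) ∅

    ∈-fromList⁺ : x ∈ xs → x ∈ˢ fromList xs
    ∈-fromList⁺ (here refl) = x∈p∪q⁺ (inj₁ (x∈⁅x⁆ _))
    ∈-fromList⁺ (there x∈)  = x∈p∪q⁺ (inj₂ (∈-fromList⁺ x∈))

    ∈-fromList⁻ : ∀ xs → x ∈ˢ fromList xs → x ∈ xs
    ∈-fromList⁻ []       x∈ = ⊥-elim (∉⊥ x∈)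
    ∈-fromList⁻ (y ∷ ys) x∈ with x∈p∪q⁻ ⁅ y ⁆ (fromList ys) x∈
    ... | inj₁ x∈y  = here (x∈⁅y⁆⇒x≡y y x∈y)
    ... | inj₂ x∈ys = there (∈-fromList⁻ ys x∈ys)

    ⊆∧∣∣≤⇒≡ : p ⊆ˢ q → ∣ q ∣ ≤ ∣ p ∣ → p ≡ q
    ⊆∧∣∣≤⇒≡ {p} {q} p⊆q q≤p = ⊆ˢ-antisym p⊆q λ {x} x∈q → inside-p x x∈q
      where
      inside-p : ∀ x → x ∈ˢ q → x ∈ˢ p
      inside-p x x∈q with x ∈ˢ? p
      ... | yes x∈p = x∈p
      ... | no  x∉p = ⊥-elim (<⇒≱ (p⊂q⇒∣p∣<∣q∣ (p⊆q , x , x∈q , x∉p)) q≤p)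

    toList : Subset n → List (Fin n)
    toList p = filter (_∈ˢ? p) (allFin n)

    toList-unique : ∀ p → Unique (toList p)
    toList-unique p = Unique.filter⁺ (_∈ˢ? p) (Unique.allFin⁺ n)

    ∈-toList⁻ : x ∈ toList p → x ∈ˢ p
    ∈-toList⁻ {p = p} x∈ = proj₂ (∈-filter⁻ (_∈ˢ? p) {xs = allFin n} x∈)

    fromList-toList : ∀ p → fromList (toList p) ≡ p
    fromList-toList p = ⊆ˢ-antisym (λ x∈ → ∈-toList⁻ (∈-fromList⁻ (toList p) x∈))
      (λ {x} x∈p → ∈-fromList⁺ (∈-filter⁺ (_∈ˢ? p) (∈-allFin x) x∈p))

  ∣⁅x⁆∪p∣≡1+∣p∣ : ∀ {n} (x : Fin n) (p : Subset n) → x ∉ˢ p → ∣ ⁅ x ⁆ ∪ p ∣ ≡ suc ∣ p ∣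
  ∣⁅x⁆∪p∣≡1+∣p∣ zero    (outside ∷ p) _   = cong (suc ∘ ∣_∣) (∪-identityˡ p)
  ∣⁅x⁆∪p∣≡1+∣p∣ zero    (inside  ∷ p) x∉p = ⊥-elim (x∉p here)
  ∣⁅x⁆∪p∣≡1+∣p∣ (suc x) (outside ∷ p) x∉p = ∣⁅x⁆∪p∣≡1+∣p∣ x p (x∉p ∘ there)
  ∣⁅x⁆∪p∣≡1+∣p∣ (suc x) (inside  ∷ p) x∉p = cong suc (∣⁅x⁆∪p∣≡1+∣p∣ x p (x∉p ∘ there))

  ∣fromList∣ : ∀ {n} {xs : List (Fin n)} → Unique xs → ∣ fromList xs ∣ ≡ length xs
  ∣fromList∣ {n} []                  = ∣⊥∣≡0 n
  ∣fromList∣ {xs = x ∷ xs} (x≢ ∷ u) = trans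
    (∣⁅x⁆∪p∣≡1+∣p∣ x (fromList xs) λ x∈ → All.lookup x≢ (∈-fromList⁻ xs x∈) refl)
    (cong suc (∣fromList∣ u))

  length-toList : ∀ {n} (p : Subset n) → length (toList p) ≡ ∣ p ∣
  length-toList p = trans (sym (∣fromList∣ (toList-unique p))) (cong ∣_∣ (fromList-toList p))

  ≡fromList : ∀ {n} {p : Subset n} {xs : List (Fin n)} → Unique xs → ∣ p ∣ ≡ length xs →
              (∀ {x} → x ∈ˢ p → x ∈ xs) → p ≡ fromList xs
  ≡fromList u size p⊆xs = ⊆∧∣∣≤⇒≡ (∈-fromList⁺ ∘ p⊆xs) (≤-reflexive (trans (∣fromList∣ u) (sym size)))

  -- Size of the threshold.

  power : ∀ c j → (2 ^ c) ^ (j + j) ≡ (2 ^ j) ^ (c + c)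
  power c j = trans (^-*-assoc 2 c (j + j)) (trans (cong (2 ^_) (exponent c j)) (sym (^-*-assoc 2 j (c + c))))
    where
    exponent : ∀ c j → c * (j + j) ≡ j * (c + c)
    exponent = solve-∀

  -- As `1 ≤ s * s`, the left side is at most three times the fourth power of `s`; 3 is rounded up
  -- to a power of two.
  baseBound : ∀ s → 1 ≤ s → s * s * suc (2 * (s * s)) ≤ 2 ^ 2 * s ^ 4
  baseBound s 1≤s = begin
    s * s * suc (2 * (s * s))               ≤⟨ *-monoʳ-≤ (s * s) (+-monoˡ-≤ (2 * (s * s)) (*-mono-≤ 1≤s 1≤s)) ⟩
    s * s * (s * s + 2 * (s * s))           ≤⟨ *-monoʳ-≤ (s * s) (+-monoˡ-≤ (2 * (s * s)) (m≤m+n (s * s) (s * s))) ⟩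
    s * s * (s * s + s * s + 2 * (s * s))   ≡⟨ regroup s ⟩
    2 ^ 2 * s ^ 4                           ∎
    where
    open ≤-Reasoning
    regroup : ∀ s → s * s * (s * s + s * s + 2 * (s * s)) ≡ 4 * (s * (s * (s * (s * 1))))
    regroup = solve-∀

  -- For D = 2 ^ 8 the exponent of 2 ^ j is 20: 16 from the 2j doubling steps, 4 from the base size.
  threshold-bound : ∀ c {D b} j → D ≡ 2 ^ c → b ≤ 2 ^ 2 * (2 ^ j) ^ 4 →
                    D ^ (j + j) * b ≤ 2 ^ 2 * (2 ^ j) ^ (c + c + 4)
  threshold-bound c {D} {b} j refl b≤ = begin
    (2 ^ c) ^ (j + j) * b                       ≡⟨ cong (_* b) (power c j) ⟩
    (2 ^ j) ^ (c + c) * b                       ≤⟨ *-monoʳ-≤ ((2 ^ j) ^ (c + c)) b≤ ⟩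
    (2 ^ j) ^ (c + c) * (2 ^ 2 * (2 ^ j) ^ 4)   ≡⟨ regroup ((2 ^ j) ^ (c + c)) ((2 ^ j) ^ 4) ⟩
    2 ^ 2 * ((2 ^ j) ^ (c + c) * (2 ^ j) ^ 4)   ≡⟨ cong (2 ^ 2 *_) (sym (^-distribˡ-+-* (2 ^ j) (c + c) 4)) ⟩
    2 ^ 2 * (2 ^ j) ^ (c + c + 4)               ∎
    where
    open ≤-Reasoning
    regroup : ∀ x y → x * (4 * y) ≡ 4 * (x * y)
    regroup = solve-∀

  -- The colouring of triples by edges and non-edges.

  module _ {n : ℕ} (H : Hypergraph₃ n) where
    open import Data.List.Membership.DecPropositional (≡-dec {n = n} _≟ᵇ_) using () renaming (_∈?_ to _∈ᴱ?_)

    triple : Fin n → Fin n → Fin n → Subset n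
    triple a b c = fromList (a ∷ b ∷ c ∷ [])

    triple-swap₁₂ : ∀ a b c → triple a b c ≡ triple b a c
    triple-swap₁₂ a b c = trans (sym (∪-assoc ⁅ a ⁆ ⁅ b ⁆ r))
      (trans (cong (_∪ r) (∪-comm ⁅ a ⁆ ⁅ b ⁆)) (∪-assoc ⁅ b ⁆ ⁅ a ⁆ r))
      where r = fromList (c ∷ [])

    triple-swap₂₃ : ∀ a b c → triple a b c ≡ triple a c b
    triple-swap₂₃ a b c = cong (⁅ a ⁆ ∪_) (trans (sym (∪-assoc ⁅ b ⁆ ⁅ c ⁆ ∅))
      (trans (cong (_∪ ∅) (∪-comm ⁅ b ⁆ ⁅ c ⁆)) (∪-assoc ⁅ c ⁆ ⁅ b ⁆ ∅)))

    edge? : ∀ a b c → Dec (triple a b c ∈ edges H)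
    edge? a b c = triple a b c ∈ᴱ? edges H

    isEdge : Fin n → Fin n → Fin n → Bool
    isEdge a b c = does (edge? a b c)

    module _ (D₂-freeH : InducedD₂Free H) where

      -- An edge inside the four-set omits one of its vertices, so it is one of four triples, two of
      -- which are excluded. The other two are distinct, so the duplicate-free list of spanned edges
      -- has length exactly two.
      not-two-edges : ∀ {a b c d} → a ≢ b → a ≢ c → a ≢ d → b ≢ c → b ≢ d → c ≢ d →
                      triple a b c ∈ edges H → triple a b d ∈ edges H →
                      triple a c d ∉ edges H → triple b c d ∉ edges H → ⊥
      not-two-edges {a} {b} {c} {d} a≢b a≢c a≢d b≢c b≢d c≢d abc abd ¬acd ¬bcd =
        D₂-freeH S (∣fromList∣ u) (≤-antisym
          (⊆⇒length≤ {ys = two} (Unique.filter⁺ (_⊆ˢ? S) (unique H)) spanned⊆two)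
          (⊆⇒length≤ ((distinct ∷ []) ∷ [] ∷ []) two⊆spanned))
        where
        S = fromList (a ∷ b ∷ c ∷ d ∷ [])
        two = triple a b c ∷ triple a b d ∷ []
        u : Unique (a ∷ b ∷ c ∷ d ∷ [])
        u = (a≢b ∷ a≢c ∷ a≢d ∷ []) ∷ (b≢c ∷ b≢d ∷ []) ∷ (c≢d ∷ []) ∷ [] ∷ []

        distinct : triple a b c ≢ triple a b d
        distinct eq with ∈-fromList⁻ (a ∷ b ∷ d ∷ []) (subst (c ∈ˢ_) eq (∈-fromList⁺ {xs = a ∷ b ∷ c ∷ []} (there (there (here refl)))))
        ... | here e                 = a≢c (sym e)
        ... | there (here e)         = b≢c (sym e)
        ... | there (there (here e)) = c≢d e

        two⊆spanned : two ⊆ spannedEdges H S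
        two⊆spanned (here refl) = ∈-filter⁺ (_⊆ˢ? S) abc λ x∈ → ∈-fromList⁺ (abc⊆ (∈-fromList⁻ _ x∈))
          where
          abc⊆ : (a ∷ b ∷ c ∷ []) ⊆ (a ∷ b ∷ c ∷ d ∷ [])
          abc⊆ (here e)                 = here e
          abc⊆ (there (here e))         = there (here e)
          abc⊆ (there (there (here e))) = there (there (here e))
        two⊆spanned (there (here refl)) = ∈-filter⁺ (_⊆ˢ? S) abd λ x∈ → ∈-fromList⁺ (abd⊆ (∈-fromList⁻ _ x∈))
          where
          abd⊆ : (a ∷ b ∷ d ∷ []) ⊆ (a ∷ b ∷ c ∷ d ∷ [])
          abd⊆ (here e)                 = here e
          abd⊆ (there (here e))         = there (here e)
          abd⊆ (there (there (here e))) = there (there (there (here e)))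

        spanned⊆two : spannedEdges H S ⊆ two
        spanned⊆two {e} e∈ with ∈-filter⁻ (_⊆ˢ? S) {xs = edges H} e∈
        ... | e∈E , e⊆S = missing (a ∈ˢ? e) (b ∈ˢ? e) (c ∈ˢ? e) (d ∈ˢ? e)
          where
          size : ∣ e ∣ ≡ 3
          size = All.lookup (uniform H) e∈E
          avoid : ∀ {x y} → x ∈ˢ e → y ∉ˢ e → x ≢ y
          avoid x∈e y∉e refl = y∉e x∈e
          missing : Dec (a ∈ˢ e) → Dec (b ∈ˢ e) → Dec (c ∈ˢ e) → Dec (d ∈ˢ e) → e ∈ two
          missing (no a∉) _ _ _ = ⊥-elim (¬bcd (subst (_∈ edges H) (≡fromList
            ((b≢c ∷ b≢d ∷ []) ∷ (c≢d ∷ []) ∷ [] ∷ []) size λ x∈ → drop x∈ (∈-fromList⁻ _ (e⊆S x∈))) e∈E))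
            where
            drop : ∀ {x} → x ∈ˢ e → x ∈ a ∷ b ∷ c ∷ d ∷ [] → x ∈ b ∷ c ∷ d ∷ []
            drop x∈e (here e)   = ⊥-elim (avoid x∈e a∉ e)
            drop x∈e (there x∈) = x∈
          missing (yes _) (no b∉) _ _ = ⊥-elim (¬acd (subst (_∈ edges H) (≡fromList
            ((a≢c ∷ a≢d ∷ []) ∷ (c≢d ∷ []) ∷ [] ∷ []) size λ x∈ → drop x∈ (∈-fromList⁻ _ (e⊆S x∈))) e∈E))
            where
            drop : ∀ {x} → x ∈ˢ e → x ∈ a ∷ b ∷ c ∷ d ∷ [] → x ∈ a ∷ c ∷ d ∷ []
            drop x∈e (here e)           = here e
            drop x∈e (there (here e))   = ⊥-elim (avoid x∈e b∉ e)
            drop x∈e (there (there x∈)) = there x∈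
          missing (yes _) (yes _) (no c∉) _ = there (here (≡fromList
            ((a≢b ∷ a≢d ∷ []) ∷ (b≢d ∷ []) ∷ [] ∷ []) size λ x∈ → drop x∈ (∈-fromList⁻ _ (e⊆S x∈))))
            where
            drop : ∀ {x} → x ∈ˢ e → x ∈ a ∷ b ∷ c ∷ d ∷ [] → x ∈ a ∷ b ∷ d ∷ []
            drop x∈e (here e)                   = here e
            drop x∈e (there (here e))           = there (here e)
            drop x∈e (there (there (here e)))   = ⊥-elim (avoid x∈e c∉ e)
            drop x∈e (there (there (there x∈))) = there (there x∈)
          missing (yes _) (yes _) (yes _) (no d∉) = here (≡fromList
            ((a≢b ∷ a≢c ∷ []) ∷ (b≢c ∷ []) ∷ [] ∷ []) size λ x∈ → drop x∈ (∈-fromList⁻ _ (e⊆S x∈)))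
            where
            drop : ∀ {x} → x ∈ˢ e → x ∈ a ∷ b ∷ c ∷ d ∷ [] → x ∈ a ∷ b ∷ c ∷ []
            drop x∈e (here e)                          = here e
            drop x∈e (there (here e))                  = there (here e)
            drop x∈e (there (there (here e)))          = there (there (here e))
            drop x∈e (there (there (there (here e)))) = ⊥-elim (avoid x∈e d∉ e)
          missing (yes a∈) (yes b∈) (yes c∈) (yes d∈) = ⊥-elim (<-irrefl refl (begin
            suc 3       ≡⟨ sym (∣fromList∣ u) ⟩
            ∣ S ∣       ≤⟨ p⊆q⇒∣p∣≤∣q∣ (λ x∈ → all-in (∈-fromList⁻ _ x∈)) ⟩
            ∣ e ∣       ≡⟨ size ⟩
            3           ∎))
            where
            open ≤-Reasoning
            all-in : ∀ {x} → x ∈ a ∷ b ∷ c ∷ d ∷ [] → x ∈ˢ e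
            all-in (here refl)                         = a∈
            all-in (there (here refl))                 = b∈
            all-in (there (there (here refl)))         = c∈
            all-in (there (there (there (here refl)))) = d∈

      private
        isEdge⁻ : ∀ {a b c} → isEdge a b c ≡ true → triple a b c ∈ edges H
        isEdge⁻ = does-true⁻ (edge? _ _ _)
        nonEdge⁻ : ∀ {a b c} → isEdge a b c ≡ false → triple a b c ∉ edges H
        nonEdge⁻ = does-false⁻ (edge? _ _ _)
        rotateTriple : ∀ a b c → triple a b c ≡ triple b c a
        rotateTriple a b c = trans (triple-swap₁₂ a b c) (triple-swap₂₃ b a c)
        move : ∀ {p q} → p ≡ q → p ∈ edges H → q ∈ edges H
        move = subst (_∈ edges H)

      edgeColouring : Colouring (Fin n)
      edgeColouring = record
        { colour  = isEdge
        ; swap₁₂  = λ a b c → cong (λ t → does (t ∈ᴱ? edges H)) (triple-swap₁₂ a b c)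
        ; swap₂₃  = λ a b c → cong (λ t → does (t ∈ᴱ? edges H)) (triple-swap₂₃ a b c)
        ; D₂-free = D₂-free
        }
        where
        D₂-free : ∀ {β γ a b c d} → β ≢ γ → a ≢ b → a ≢ c → a ≢ d → b ≢ c → b ≢ d → c ≢ d →
                  isEdge a b c ≡ γ → isEdge a b d ≡ γ → isEdge a c d ≡ β → isEdge b c d ≡ β → ⊥
        D₂-free {true}  {true}  β≢γ = ⊥-elim (β≢γ refl)
        D₂-free {false} {false} β≢γ = ⊥-elim (β≢γ refl)
        D₂-free {false} {true}  _ a≢b a≢c a≢d b≢c b≢d c≢d abc abd acd bcd =
          not-two-edges a≢b a≢c a≢d b≢c b≢d c≢d (isEdge⁻ abc) (isEdge⁻ abd) (nonEdge⁻ acd) (nonEdge⁻ bcd)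
        -- When the non-edges share `a b`, the two edges share `c d`, so the vertices are read in
        -- the order `c d a b`.
        D₂-free {true} {false} {a} {b} {c} {d} _ a≢b a≢c a≢d b≢c b≢d c≢d abc abd acd bcd =
          not-two-edges c≢d (≢-sym a≢c) (≢-sym b≢c) (≢-sym a≢d) (≢-sym b≢d) a≢b
            (move (rotateTriple a c d) (isEdge⁻ acd)) (move (rotateTriple b c d) (isEdge⁻ bcd))
            (nonEdge⁻ abc ∘ move (rotateTriple c a b)) (nonEdge⁻ abd ∘ move (rotateTriple d a b))

      mono⇒homogeneous : ∀ {β X} → Mono _≟ᶠ_ edgeColouring β X →
                         IsClique H (fromList X) ⊎ IsIndependent H (fromList X)
      mono⇒homogeneous {β} {X} mono = by-colour β mono
        where
        on-triples : ∀ {β} → Mono _≟ᶠ_ edgeColouring β X → ∀ e → e ⊆ˢ fromList X → ∣ e ∣ ≡ 3 →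
                     does (e ∈ᴱ? edges H) ≡ β
        on-triples mono e e⊆X size
          -- Listing the elements of `e` replaces it by a triple of three distinct vertices, to
          -- which `Mono` applies.
          with toList e | toList-unique e | trans (length-toList e) size | fromList-toList e | (λ {x} → ∈-toList⁻ {x = x} {p = e})
        ... | a ∷ b ∷ c ∷ [] | (a≢b ∷ a≢c ∷ []) ∷ (b≢c ∷ []) ∷ [] ∷ [] | _ | refl | _ =
          mono (inX (here refl)) (inX (there (here refl))) (inX (there (there (here refl)))) a≢b a≢c b≢c
          where
          inX : ∀ {x} → x ∈ a ∷ b ∷ c ∷ [] → x ∈ X
          inX x∈ = ∈-fromList⁻ X (e⊆X (∈-fromList⁺ x∈))
        by-colour : ∀ β → Mono _≟ᶠ_ edgeColouring β X → IsClique H (fromList X) ⊎ IsIndependent H (fromList X)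
        by-colour true  mono = inj₁ λ e e⊆X size → does-true⁻ (e ∈ᴱ? edges H) (on-triples mono e e⊆X size)
        by-colour false mono = inj₂ λ e e⊆X size → does-false⁻ (e ∈ᴱ? edges H) (on-triples mono e e⊆X size)

      -- For `s = 2 ^ j` the square is exactly `2 ^ (j + j)`, so `large-mono` is run with `j + j`
      -- doublings.
      homogeneous-subset : ∀ j → 2 ^ 2 * (2 ^ j) ^ 20 ≤ n →
                           ∃[ X ] ((IsClique H X ⊎ IsIndependent H X) × 2 ^ j ≤ ∣ X ∣)
      homogeneous-subset j n-large = from-mono (large-mono _≟ᶠ_ edgeColouring (2 ^ j) {A = allFin n} (j + j)
        (≤-reflexive (sym (^-distribˡ-+-* 2 j j))) (Unique.allFin⁺ n)
        (≤-trans (threshold-bound 8 j refl (baseBound (2 ^ j) (m^n>0 2 j)))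
          (≤-trans n-large (≤-reflexive (sym (length-tabulate id))))))
        where
        instance
          2^j-nonZero : NonZero (2 ^ j)
          2^j-nonZero = m^n≢0 2 j
        from-mono : LargeMono _≟ᶠ_ edgeColouring (2 ^ j) →
                    ∃[ X ] ((IsClique H X ⊎ IsIndependent H X) × 2 ^ j ≤ ∣ X ∣)
        from-mono (_ , X , uX , mono , le) =
          fromList X , mono⇒homogeneous mono , ≤-trans le (≤-reflexive (sym (∣fromList∣ uX)))

    small⇒clique : ∀ {X} → ∣ X ∣ ≤ 2 → IsClique H X
    small⇒clique small e e⊆X size =
      ⊥-elim (<-irrefl refl (≤-trans (≤-reflexive (sym size)) (≤-trans (p⊆q⇒∣p∣≤∣q∣ e⊆X) small)))

  -- From powers of two to all n, and the exponent.

  bracket : ∀ (h : ℕ → ℕ) {n} k → n ≤ h k → n ≤ h 0 ⊎ ∃[ j ] (h j ≤ n × n ≤ h (suc j))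
  bracket h zero    n≤ = inj₁ n≤
  bracket h {n} (suc k) n≤ with n ≤? h k
  ... | yes p = bracket h k p
  ... | no ¬p = inj₂ (k , <⇒≤ (≰⇒> ¬p) , n≤)

  n<2^n : ∀ n → n < 2 ^ n
  n<2^n zero    = s≤s z≤n
  n<2^n (suc n) = begin
    2 + n              ≡⟨ +-comm 1 (suc n) ⟩
    suc n + 1          ≤⟨ +-mono-≤ (n<2^n n) (m^n>0 2 n) ⟩
    2 ^ n + 2 ^ n      ≡⟨ cong (2 ^ n +_) (sym (+-identityʳ _)) ⟩
    2 * 2 ^ n          ∎
    where open ≤-Reasoning

  ^-distribʳ-* : ∀ o m n → (m * n) ^ o ≡ m ^ o * n ^ o
  ^-distribʳ-* zero    m n = refl
  ^-distribʳ-* (suc o) m n = trans (cong (m * n *_) (^-distribʳ-* o m n)) ([m*n]*[o*p]≡[m*o]*[n*p] m n (m ^ o) (n ^ o))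

  -- Bounds the threshold for the next size `2 * s` by a power of the current size `s`: every factor
  -- 2 is absorbed into a factor `s`.
  threshold-growth : ∀ a b {s} → 2 ≤ s → 2 ^ a * (2 * s) ^ b ≤ s ^ (a + (b + b))
  threshold-growth a b {s} 2≤s = begin
    2 ^ a * (2 * s) ^ b        ≡⟨ cong (2 ^ a *_) (^-distribʳ-* b 2 s) ⟩
    2 ^ a * (2 ^ b * s ^ b)    ≤⟨ *-mono-≤ (^-monoˡ-≤ a 2≤s) (*-monoˡ-≤ (s ^ b) (^-monoˡ-≤ b 2≤s)) ⟩
    s ^ a * (s ^ b * s ^ b)    ≡⟨ cong (s ^ a *_) (sym (^-distribˡ-+-* s b b)) ⟩
    s ^ a * s ^ (b + b)        ≡⟨ sym (^-distribˡ-+-* s a (b + b)) ⟩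
    s ^ (a + (b + b))          ∎
    where open ≤-Reasoning

  bounded : ∀ a b n → n ≤ 2 ^ a * (2 ^ suc n) ^ suc b
  bounded a b n = begin
    n                             ≤⟨ <⇒≤ (n<2^n n) ⟩
    2 ^ n                         ≤⟨ ^-monoʳ-≤ 2 (n≤1+n n) ⟩
    2 ^ suc n                     ≤⟨ m≤m*n (2 ^ suc n) ((2 ^ suc n) ^ b) {{m^n≢0 (2 ^ suc n) b {{m^n≢0 2 (suc n)}}}} ⟩
    (2 ^ suc n) ^ suc b           ≤⟨ m≤n*m _ (2 ^ a) {{m^n≢0 2 a}} ⟩
    2 ^ a * (2 ^ suc n) ^ suc b   ∎
    where open ≤-Reasoning

  -- Sets of at most two vertices are cliques vacuously, and two vertices suffice while `n ≤ 2 ^ m`;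
  -- `n` equal to 0 or 1 is handled by all available vertices.
  small-case : ∀ n (H : Hypergraph₃ n) m → n ≤ 2 ^ m →
               ∃[ X ] ((IsClique H X ⊎ IsIndependent H X) × n ≤ ∣ X ∣ ^ m)
  small-case zero          H m _  = ∅ , inj₁ (small⇒clique H {∅} z≤n) , z≤n
  small-case (suc zero)    H m _  = full , inj₁ (small⇒clique H {full} (s≤s z≤n)) , ≤-reflexive (sym (^-zeroˡ m))
  small-case (suc (suc n)) H m n≤ = X , inj₁ (small⇒clique H {X} (≤-reflexive size)) ,
    ≤-trans n≤ (≤-reflexive (cong (_^ m) (sym size)))
    where
    X = fromList (zero ∷ suc zero ∷ [])
    size : ∣ X ∣ ≡ 2
    size = ∣fromList∣ {suc (suc n)} {zero ∷ suc zero ∷ []} (((λ ()) ∷ []) ∷ [] ∷ [])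

  -- The sizes are `2 ^ suc j`, starting at 2 so that `threshold-growth` applies. Below the first
  -- threshold, `n` is small enough for `small-case`.
  scale : ∀ a b n → let c = suc b in
          n ≤ 2 ^ (a + (c + c)) ⊎
          ∃[ j ] (2 ^ a * (2 ^ suc j) ^ c ≤ n × n ≤ (2 ^ suc j) ^ (a + (c + c)))
  scale a b n with bracket (λ j → 2 ^ a * (2 ^ suc j) ^ suc b) n (bounded a b n)
  ... | inj₁ n≤ = inj₁ (≤-trans n≤ (≤-trans
    (*-monoʳ-≤ (2 ^ a) (^-monoˡ-≤ (suc b) (m≤m+n 2 2))) (threshold-growth a (suc b) ≤-refl)))
  ... | inj₂ (j , large , n≤) =
    inj₂ (j , large , ≤-trans n≤ (threshold-growth a (suc b) (m≤m*n 2 (2 ^ j) {{m^n≢0 2 j}})))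

  homogeneous : ∀ n (H : Hypergraph₃ n) → InducedD₂Free H →
                ∃[ X ] ((IsClique H X ⊎ IsIndependent H X) × n ≤ ∣ X ∣ ^ 42)
  -- With `a = 2` and `c = 20` from the threshold `2 ^ 2 * (2 ^ suc j) ^ 20`, the exponent is
  -- `2 + 20 + 20 = 42`.
  homogeneous n H free = [ small-case n H 42 , large-case ]′ (scale 2 19 n)
    where
    large-case : ∃[ j ] (2 ^ 2 * (2 ^ suc j) ^ 20 ≤ n × n ≤ (2 ^ suc j) ^ 42) →
                 ∃[ X ] ((IsClique H X ⊎ IsIndependent H X) × n ≤ ∣ X ∣ ^ 42)
    large-case (j , large , n≤) =
      let X , homog , big = homogeneous-subset H free (suc j) large in
      X , homog , ≤-trans n≤ (^-monoˡ-≤ 42 big)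

  -- The rational 1/42; the constructor stores the denominator minus one.
  exponent : ℚ.ℚ
  exponent = ℚ.mkℚ (ℤ.+ 1) 41 (1-coprimeTo 42)

  exponent-positive : ℚ.0ℚ ℚ.< exponent
  exponent-positive = ℚ.*<* (ℤ.+<+ (s≤s z≤n))

  atLeastPower : ∀ m n → n ≤ m ^ 42 → AtLeastPower m n exponent
  atLeastPower m n = ≤-trans (≤-reflexive (*-identityʳ n))

open import Data.Rational using (ℚ; 0ℚ; _<_)

theorem1p2 : ∃[ c ] (0ℚ < c × (∀ (n : ℕ) (H : Hypergraph₃ n) → InducedD₂Free H →
    ∃[ X ] ((IsClique H X ⊎ IsIndependent H X) × AtLeastPower ∣ X ∣ n c)))
theorem1p2 = exponent , exponent-positive , λ n H free →
  let X , homog , n≤ = homogeneous n H free in X , homog , atLeastPower ∣ X ∣ n n≤
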